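{- For every integer $n\ge 0$ and every $r\in\{68,132\}$, $$v_0(160n+r)\equiv 0\pmod{25}.$$
   Context: The integer sequence $v_0(n)$, $n\ge 0$, is defined by the generating function (formal power series in $q$) $$\sum_{n=0}^\infty v_0(n)q^n=\sum_{n=0}^\infty \frac{q^{n^2}(-q;q^2)_n}{(q;q^2)_n},$$ where $(a;q)_0=1$ and $(a;q)_n=\prod_{i=1}^n(1-aq^{i-1})$ for $n\ge1$, so that $(-q;q^2)_n=\prod_{i=1}^n(1+q^{2i-1})$ and $(q;q^2)_n=\prod_{i=1}^n(1-q^{2i-1})$. -}

module Defs where

open import Data.Nat.Base as ℕ using (ℕ; zero; suc; _∸_; _<_; _≤_; z≤n; s≤s)
import Data.Nat.Properties as ℕ
open import Data.Integer.Base using (ℤ; 0ℤ; 1ℤ; _+_; _-_; _*_; -_)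
open import Data.Integer.Properties
  using (+-*-semiring; *-identityˡ; *-zeroˡ; *-zeroʳ; +-inverseˡ)
open import Data.Fin.Base using (Fin; zero; suc; toℕ)
open import Data.Fin.Properties using (toℕ≤pred[n])
open import Data.Vec.Base using (Vec; []; _∷_; head; lookup)
open import Data.Sum.Base using (inj₁; inj₂)
open import Relation.Binary.PropositionalEquality
  using (_≡_; _≗_; refl; sym; trans; cong; cong₂; subst; module ≡-Reasoning)
open import Algebra.Properties.Semiring.Sum +-*-semiring
  using (sum⁺-syntax; sum-cong-≗; sum-replicate-zero)

-- The series f stands for Σₙ f(n) qⁿ.
Series : Set
Series = ℕ → ℤ

𝟙 : Series
𝟙 zero    = 1ℤ
𝟙 (suc _) = 0ℤ

q : Series
q 1 = 1ℤ
q _ = 0ℤ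

infix  8 ⊖_
infixl 6 _⊝_
infixl 7 _⊛_ _⊘_
infixr 9 _^_

⊖_ : Series → Series
(⊖ f) n = - f n

_⊝_ : Series → Series → Series
(f ⊝ g) n = f n - g n

_⊛_ : Series → Series → Series
(f ⊛ g) n = ∑[ i ≤ n ] (f (toℕ i) * g (n ∸ toℕ i))

_^_ : Series → ℕ → Series
f ^ zero  = 𝟙
f ^ suc k = f ⊛ f ^ k

-- The coefficients n, n-1, …, 0 (in this order) of 1/f, for a series f with
-- constant term 1, obtained by solving f · (1/f) = 1 recursively.
invCoeffs : Series → (n : ℕ) → Vec ℤ (suc n)
invCoeffs f zero    = 1ℤ ∷ []
invCoeffs f (suc n) =
  - (∑[ j ≤ n ] (f (suc (toℕ j)) * lookup (invCoeffs f n) j)) ∷ invCoeffs f n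

-- Only meaningful when f has constant term 1; see ⊛-inv.
inv : Series → Series
inv f n = head (invCoeffs f n)

_⊘_ : Series → Series → Series
g ⊘ f = g ⊛ inv f

-- The sum Σₙ F n of a family in which F n is divisible by qⁿ, so that only
-- F 0, …, F m contribute to the coefficient of qᵐ.
Σ∞ : (ℕ → Series) → Series
Σ∞ F m = ∑[ n ≤ m ] (F (toℕ n) m)

-- (a;b)ₙ = ∏_{i=1}^{n} (1 - a bⁱ⁻¹)
⟨_⨾_⟩_ : Series → Series → ℕ → Series
⟨ a ⨾ b ⟩ zero  = 𝟙
⟨ a ⨾ b ⟩ suc n = ⟨ a ⨾ b ⟩ n ⊛ (𝟙 ⊝ a ⊛ b ^ n)

v₀-term : ℕ → Series
v₀-term n = q ^ (n ℕ.* n) ⊛ ⟨ ⊖ q ⨾ q ^ 2 ⟩ n ⊘ ⟨ q ⨾ q ^ 2 ⟩ n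

v₀ : ℕ → ℤ
v₀ = Σ∞ v₀-term

-- The remaining lemmas check that the division and the infinite sum in v₀
-- are used only where they are meaningful.

lookup-invCoeffs : ∀ f n (j : Fin (suc n)) →
  lookup (invCoeffs f n) j ≡ inv f (n ∸ toℕ j)
lookup-invCoeffs f zero    zero    = refl
lookup-invCoeffs f (suc n) zero    = refl
lookup-invCoeffs f (suc n) (suc j) = lookup-invCoeffs f n j

⊛-inv : ∀ f → f 0 ≡ 1ℤ → f ⊛ inv f ≗ 𝟙
⊛-inv f f0 zero rewrite f0 = refl
⊛-inv f f0 (suc n) = begin
  f 0 * (- s) + (∑[ j ≤ n ] (f (suc (toℕ j)) * inv f (n ∸ toℕ j)))
    ≡⟨ cong₂ _+_ (trans (cong (_* (- s)) f0) (*-identityˡ (- s)))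
         (sum-cong-≗ {suc n} (λ j → cong (f (suc (toℕ j)) *_)
           (sym (lookup-invCoeffs f n j)))) ⟩
  - s + s
    ≡⟨ +-inverseˡ s ⟩
  0ℤ ∎
  where
  open ≡-Reasoning
  s = ∑[ j ≤ n ] (f (suc (toℕ j)) * lookup (invCoeffs f n) j)

poch-const : ∀ n → (⟨ q ⨾ q ^ 2 ⟩ n) 0 ≡ 1ℤ
poch-const zero = refl
poch-const (suc n) rewrite poch-const n | *-zeroˡ (((q ^ 2) ^ n) 0) = refl

VanishesBelow : ℕ → Series → Set
VanishesBelow k f = ∀ {m} → m < k → f m ≡ 0ℤ

⊛-vanishes : ∀ {k l f g} → VanishesBelow k f → VanishesBelow l g →
  VanishesBelow (k ℕ.+ l) (f ⊛ g)
⊛-vanishes {k} {l} {f} {g} vf vg {m} m<k+l =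
  trans (sum-cong-≗ {suc m} (λ i → summand (toℕ i) (toℕ≤pred[n] i)))
        (sum-replicate-zero (suc m))
  where
  summand : ∀ i → i ≤ m → f i * g (m ∸ i) ≡ 0ℤ
  summand i i≤m with ℕ.<-≤-connex i k
  ... | inj₁ i<k = trans (cong (_* g (m ∸ i)) (vf i<k)) (*-zeroˡ (g (m ∸ i)))
  ... | inj₂ k≤i = trans (cong (f i *_) (vg m∸i<l)) (*-zeroʳ (f i))
    where
    m∸i<l : m ∸ i < l
    m∸i<l = ℕ.+-cancelˡ-< i (m ∸ i) l
      (subst (_< i ℕ.+ l) (sym (ℕ.m+[n∸m]≡n i≤m))
        (ℕ.<-≤-trans m<k+l (ℕ.+-monoˡ-≤ l k≤i)))

q^-vanishes : ∀ k → VanishesBelow k (q ^ k)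
q^-vanishes (suc k) = ⊛-vanishes {1} {k} q-vanishes (q^-vanishes k)
  where
  q-vanishes : VanishesBelow 1 q
  q-vanishes (s≤s z≤n) = refl

⊛-vanishesˡ : ∀ {k f} g → VanishesBelow k f → VanishesBelow k (f ⊛ g)
⊛-vanishesˡ {k} {f} g vf m<k =
  ⊛-vanishes {k} {0} {f} {g} vf (λ ()) (subst (_ <_) (sym (ℕ.+-identityʳ k)) m<k)

v₀-term-vanishes : ∀ n → VanishesBelow n (v₀-term n)
v₀-term-vanishes n m<n =
  ⊛-vanishesˡ (inv (⟨ q ⨾ q ^ 2 ⟩ n))
    (⊛-vanishesˡ (⟨ ⊖ q ⨾ q ^ 2 ⟩ n) (q^-vanishes (n ℕ.* n)))
    (ℕ.<-≤-trans m<n (n≤n*n n))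
  where
  n≤n*n : ∀ n → n ≤ n ℕ.* n
  n≤n*n zero    = z≤n
  n≤n*n (suc n) = ℕ.m≤m*n (suc n) (suc n)

{-# OPTIONS --safe #-}
-- Write x = q², y = q⁴, w = q³² and φ(z) = Σ z^{n²}, Ψ(z) = Σ z^{n(n+1)/2} (n ∈ ℤ).
-- The reflection n ↦ - n shows that B(q) = V(q) + V(-q) - 1, where V generates v₀,
-- is the bilateral series Σ_{n ∈ ℤ} q^{n²} (-q;q²)_n / (q;q²)_n. Replacing its base
-- point q by a variable u gives a functional equation under u ↦ uq², and iterating
-- it down to u = 0 gives B φ(-x²) = φ(x)². Dissections of theta functions,
-- consequences of the triple product, then yield
--   B φ(-w)⁸ = (exponents ≢ 4 mod 32) + y (3 Ψ(w) φ(-w)⁸ + 2 w Ψ(w)⁹),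
-- and Ψ(w)⁹ φ(-w)¹⁷ = 2⁹ J(w²) J(w)²⁵ with J(w) = (w;w)_∞. Multiply by φ(-w)¹⁷:
-- modulo 25 only exponents divisible by 5 survive in a 25th power, and the exponents
-- of y Ψ(w) and, by the pentagonal number theorem, of y w J(w²) are 0 or ±1 modulo 5,
-- whereas the exponents 160n + 68 and 160n + 132 are ±2 modulo 5 and 4 modulo 32.

module Submission where

open import Defs
open import Level using (0ℓ)
open import Function.Base using (_∘_)
open import Data.Empty using (⊥; ⊥-elim)
open import Data.Product.Base using (_,_; _×_; ∃-syntax)
open import Data.Sum.Base using (_⊎_; inj₁; inj₂; map₂) renaming (map to ⊎-map)
open import Data.Maybe.Base using (Maybe; just; nothing)
open import Data.Fin.Base using (toℕ)
open import Data.Fin.Properties using (toℕ≤pred[n])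
open import Data.List.Base using (_∷_; [])
open import Data.List.Membership.Propositional using (_∈_)
open import Data.List.Relation.Unary.Any using (here; there)
open import Data.Nat.Base as ℕ using (ℕ; zero; suc; _+_; _*_; _∸_; _<_; _≤_; z≤n; s≤s)
import Data.Nat.Properties as ℕ
import Data.Nat.Divisibility as ℕ
import Data.Nat.Induction as ℕ
open import Data.Nat.DivMod using (_%_; %-distribˡ-+; [m+kn]%n≡m%n; m∣n⇒o%n%m≡o%m; m%n%n≡m%n)
open import Data.Nat.Tactic.RingSolver using () renaming (solve-∀ to ℕ-solve-∀)
open import Data.Integer.Base as ℤ using (ℤ; +_; -[1+_]; 0ℤ; 1ℤ)
import Data.Integer.Properties as ℤ
open import Data.Integer.Divisibility.Signed
  using (_∣_; divides; ∣-trans; ∣m∣n⇒∣m+n; ∣m⇒∣-m; ∣m⇒∣m*n; ∣n⇒∣m*n; ∣m+n∣n⇒∣m)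
open import Data.Integer.Tactic.RingSolver using (solve-∀)
open import Relation.Nullary.Decidable using (Dec; yes; no; ¬?; _×-dec_; from-yes)
open import Relation.Nullary.Negation using (¬_)
open import Relation.Binary.Bundles using (Setoid)
open import Relation.Binary.PropositionalEquality
  using (_≡_; _≢_; _≗_; refl; sym; trans; cong; cong₂; subst; module ≡-Reasoning)
import Relation.Binary.Reasoning.Setoid as SetoidReasoning
open import Algebra.Bundles using (CommutativeRing)
open import Algebra.Properties.Semiring.Sum ℤ.+-*-semiring as ℤSum using (sum-cong-≗)
open import Algebra.Solver.Ring.AlmostCommutativeRing
  using (_-Raw-AlmostCommutative⟶_; fromCommutativeRing)

-- In v₀ the point q is tied to the base q², so no functional equation is visible; a variable u over
-- a fixed base p can move to u p. The series in u are multiplied by (u;p)_∞, which removes their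
-- denominators and makes u = 0 admissible. The exponents 8 and 17 have these origins. B = φ(x)² /
-- φ(-y) has a denominator in q⁴, which mixes residues modulo 32. Each use of φ(z) φ(-z) = φ(-z²)²
-- squares the argument and doubles the power, so three uses trade φ(-y) for φ(-w)⁸, a series in
-- q³². Since Ψ(w) = 2 J(w²)² / J(w) and φ(-w) = J(w)² / J(w²), multiplying by φ(-w)ᵏ leaves J(w) to
-- the power 2k - 9 in one summand and φ(-w) to the power 8 + k in the other; for k = 17 both powers
-- are 25. The factor φ(-w)²⁵ has, modulo 25, only exponents divisible by 160, so dividing by it
-- keeps residue classes modulo 160 apart, and the congruence passes from the product back to B. At
-- even positive exponents the coefficient of B is twice that of V, and 2 is invertible modulo 25.

-- The commutative ring of power series.

tail : Series → Series
tail f n = f (suc n)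

infix 4 _≋_
record _≋_ (f g : Series) : Set where
  constructor pointwise
  field at : f ≗ g
open _≋_

≋-refl : ∀ {f} → f ≋ f
≋-refl .at _ = refl

≋-sym : ∀ {f g} → f ≋ g → g ≋ f
≋-sym e .at n = sym (at e n)

≋-trans : ∀ {f g h} → f ≋ g → g ≋ h → f ≋ h
≋-trans e e′ .at n = trans (at e n) (at e′ n)

-- Opaque copies of the operations on series: conversion checking must not
-- η-expand and unfold them down to their coefficients.
infixl 6 _⊕_
infixl 7 _·_
infix  8 −_
opaque
  𝟎 𝟏 : Series
  𝟎 _ = 0ℤ
  𝟏 = 𝟙

  _⊕_ _·_ : Series → Series → Series
  (f ⊕ g) n = f n ℤ.+ g n
  _·_ = _⊛_

  −_ : Series → Series
  −_ = ⊖_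

opaque
  unfolding _·_

  𝟎-at : ∀ n → 𝟎 n ≡ 0ℤ
  𝟎-at n = refl

  ⊕-at : ∀ f g n → (f ⊕ g) n ≡ f n ℤ.+ g n
  ⊕-at f g n = refl

  −-at : ∀ f n → (− f) n ≡ ℤ.- f n
  −-at f n = refl

  𝟏≡𝟙 : 𝟏 ≡ 𝟙
  𝟏≡𝟙 = refl

  −≡⊖ : ∀ f → − f ≡ ⊖ f
  −≡⊖ f = refl

  ·-zero : ∀ f g → (f · g) 0 ≡ f 0 ℤ.* g 0
  ·-zero f g = ℤ.+-identityʳ _

  -- The convolution sum computes to this recursion. It replaces all work with double sums: the ring
  -- laws follow by induction on the exponent, with `f` replaced by its tail.
  ·-suc : ∀ f g n → (f · g) (suc n) ≡ f 0 ℤ.* g (suc n) ℤ.+ (tail f · g) n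
  ·-suc f g n = refl

  ·-cong-upto : ∀ {f f′ g g′} n → (∀ i → i ≤ n → f i ≡ f′ i) → (∀ i → i ≤ n → g i ≡ g′ i) →
    (f · g) n ≡ (f′ · g′) n
  ·-cong-upto {f} {f′} {g} {g′} n ef eg = sum-cong-≗ {suc n} λ i →
    cong₂ ℤ._*_ (ef (toℕ i) (toℕ≤pred[n] i)) (eg (n ∸ toℕ i) (ℕ.m∸n≤m n (toℕ i)))

  ⊕-cong : ∀ {f f′ g g′} → f ≋ f′ → g ≋ g′ → f ⊕ g ≋ f′ ⊕ g′
  ⊕-cong e e′ .at n = cong₂ ℤ._+_ (at e n) (at e′ n)

  ·-cong : ∀ {f f′ g g′} → f ≋ f′ → g ≋ g′ → f · g ≋ f′ · g′
  ·-cong e e′ .at n = ·-cong-upto n (λ i _ → at e i) (λ i _ → at e′ i)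

  −-cong : ∀ {f f′} → f ≋ f′ → − f ≋ − f′
  −-cong e .at n = cong ℤ.-_ (at e n)

  ·-zeroˡ : ∀ f n → (𝟎 · f) n ≡ 0ℤ
  ·-zeroˡ f zero = trans (·-zero 𝟎 f) (ℤ.*-zeroˡ (f 0))
  ·-zeroˡ f (suc n) = cong₂ ℤ._+_ (ℤ.*-zeroˡ (f (suc n))) (·-zeroˡ f n)

  ·-identityˡ : ∀ f n → (𝟏 · f) n ≡ f n
  ·-identityˡ f zero = trans (·-zero 𝟏 f) (ℤ.*-identityˡ (f 0))
  ·-identityˡ f (suc n) =
    trans (cong₂ ℤ._+_ (ℤ.*-identityˡ (f (suc n))) (·-zeroˡ f n)) (ℤ.+-identityʳ _)

  ·-distribʳ : ∀ f g h n → ((f ⊕ g) · h) n ≡ (f · h ⊕ g · h) n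
  ·-distribʳ f g h zero = trans (·-zero (f ⊕ g) h)
    (trans (ℤ.*-distribʳ-+ (h 0) (f 0) (g 0)) (sym (cong₂ ℤ._+_ (·-zero f h) (·-zero g h))))
  ·-distribʳ f g h (suc n) =
    trans (cong (ℤ._+_ ((f 0 ℤ.+ g 0) ℤ.* h (suc n))) (·-distribʳ (tail f) (tail g) h n))
      (rearrange (f 0) (g 0) (h (suc n)) ((tail f · h) n) ((tail g · h) n))
    where
    rearrange : ∀ a b c d e → (a ℤ.+ b) ℤ.* c ℤ.+ (d ℤ.+ e) ≡ (a ℤ.* c ℤ.+ d) ℤ.+ (b ℤ.* c ℤ.+ e)
    rearrange = solve-∀

  scale : ℤ → Series → Series
  scale c f n = c ℤ.* f n

  ·-scaleˡ : ∀ c f g n → (scale c f · g) n ≡ c ℤ.* (f · g) n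
  ·-scaleˡ c f g zero = trans (·-zero (scale c f) g)
    (trans (ℤ.*-assoc c (f 0) (g 0)) (sym (cong (c ℤ.*_) (·-zero f g))))
  ·-scaleˡ c f g (suc n) =
    trans (cong (ℤ._+_ ((c ℤ.* f 0) ℤ.* g (suc n))) (·-scaleˡ c (tail f) g n))
      (rearrange c (f 0) (g (suc n)) ((tail f · g) n))
    where
    rearrange : ∀ a b c d → (a ℤ.* b) ℤ.* c ℤ.+ a ℤ.* d ≡ a ℤ.* (b ℤ.* c ℤ.+ d)
    rearrange = solve-∀

  ·-sucʳ : ∀ f g n → (f · g) (suc n) ≡ f (suc n) ℤ.* g 0 ℤ.+ (f · tail g) n
  ·-sucʳ f g zero =
    trans (cong (ℤ._+_ (f 0 ℤ.* g 1)) (·-zero (tail f) g))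
      (trans (ℤ.+-comm (f 0 ℤ.* g 1) (f 1 ℤ.* g 0))
        (cong (ℤ._+_ (f 1 ℤ.* g 0)) (sym (·-zero f (tail g)))))
  ·-sucʳ f g (suc n) =
    trans (cong (ℤ._+_ (f 0 ℤ.* g (suc (suc n)))) (·-sucʳ (tail f) g n))
      (rearrange (f 0 ℤ.* g (suc (suc n))) (f (suc (suc n)) ℤ.* g 0) _)
    where
    rearrange : ∀ a b c → a ℤ.+ (b ℤ.+ c) ≡ b ℤ.+ (a ℤ.+ c)
    rearrange = solve-∀

  ·-comm′ : ∀ f g n → (f · g) n ≡ (g · f) n
  ·-comm′ f g zero =
    trans (·-zero f g) (trans (ℤ.*-comm (f 0) (g 0)) (sym (·-zero g f)))
  ·-comm′ f g (suc n) =
    trans (cong₂ ℤ._+_ (ℤ.*-comm (f 0) (g (suc n))) (·-comm′ (tail f) g n))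
      (sym (·-sucʳ g f n))

  ·-assoc′ : ∀ f g h n → ((f · g) · h) n ≡ (f · (g · h)) n
  ·-assoc′ f g h zero =
    trans (·-zero (f · g) h) (trans (cong (ℤ._* h 0) (·-zero f g))
      (trans (ℤ.*-assoc (f 0) (g 0) (h 0))
        (sym (trans (·-zero f (g · h)) (cong (f 0 ℤ.*_) (·-zero g h))))))
  ·-assoc′ f g h (suc n) = begin
    (f · g) 0 ℤ.* h (suc n) ℤ.+ (tail (f · g) · h) n
      -- By the recursion for products, `tail (f · g)` is definitionally `f 0` times `tail g`, plus
      -- `tail f · g`.
      ≡⟨ cong₂ ℤ._+_ (cong (ℤ._* h (suc n)) (·-zero f g))
          (·-distribʳ (scale (f 0) (tail g)) (tail f · g) h n) ⟩
    (f 0 ℤ.* g 0) ℤ.* h (suc n) ℤ.+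
      ((scale (f 0) (tail g) · h) n ℤ.+ ((tail f · g) · h) n)
      ≡⟨ cong (ℤ._+_ ((f 0 ℤ.* g 0) ℤ.* h (suc n)))
          (cong₂ ℤ._+_ (·-scaleˡ (f 0) (tail g) h n) (·-assoc′ (tail f) g h n)) ⟩
    (f 0 ℤ.* g 0) ℤ.* h (suc n) ℤ.+
      (f 0 ℤ.* (tail g · h) n ℤ.+ (tail f · (g · h)) n)
      ≡⟨ rearrange (f 0) (g 0) (h (suc n)) ((tail g · h) n) ((tail f · (g · h)) n) ⟩
    f 0 ℤ.* (g 0 ℤ.* h (suc n) ℤ.+ (tail g · h) n) ℤ.+ (tail f · (g · h)) n ∎
    where
    open ≡-Reasoning
    rearrange : ∀ a b c d e →
      (a ℤ.* b) ℤ.* c ℤ.+ (a ℤ.* d ℤ.+ e) ≡ a ℤ.* (b ℤ.* c ℤ.+ d) ℤ.+ e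
    rearrange = solve-∀

  ·-distribˡ : ∀ f g h n → (f · (g ⊕ h)) n ≡ (f · g ⊕ f · h) n
  ·-distribˡ f g h n = trans (·-comm′ f (g ⊕ h) n) (trans (·-distribʳ g h f n)
    (cong₂ ℤ._+_ (·-comm′ g f n) (·-comm′ h f n)))

  ⊕-assoc′ : ∀ f g h n → ((f ⊕ g) ⊕ h) n ≡ (f ⊕ (g ⊕ h)) n
  ⊕-assoc′ f g h n = ℤ.+-assoc (f n) (g n) (h n)

  ⊕-comm′ : ∀ f g n → (f ⊕ g) n ≡ (g ⊕ f) n
  ⊕-comm′ f g n = ℤ.+-comm (f n) (g n)

  ⊕-identityˡ′ : ∀ f n → (𝟎 ⊕ f) n ≡ f n
  ⊕-identityˡ′ f n = ℤ.+-identityˡ (f n)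

  ⊕-identityʳ′ : ∀ f n → (f ⊕ 𝟎) n ≡ f n
  ⊕-identityʳ′ f n = ℤ.+-identityʳ (f n)

  −-inverseˡ : ∀ f n → (− f ⊕ f) n ≡ 𝟎 n
  −-inverseˡ f n = ℤ.+-inverseˡ (f n)

  −-inverseʳ : ∀ f n → (f ⊕ − f) n ≡ 𝟎 n
  −-inverseʳ f n = ℤ.+-inverseʳ (f n)

  scale-𝟏-+ : ∀ c d n → scale (c ℤ.+ d) 𝟏 n ≡ (scale c 𝟏 ⊕ scale d 𝟏) n
  scale-𝟏-+ c d n = ℤ.*-distribʳ-+ (𝟙 n) c d

  scale-𝟏-* : ∀ c d n → scale (c ℤ.* d) 𝟏 n ≡ (scale c 𝟏 · scale d 𝟏) n
  scale-𝟏-* c d n = trans (ℤ.*-assoc c d (𝟙 n))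
    (sym (trans (·-scaleˡ c 𝟏 (scale d 𝟏) n) (cong (c ℤ.*_) (·-identityˡ (scale d 𝟏) n))))

  scale-𝟏-neg : ∀ c n → scale (ℤ.- c) 𝟏 n ≡ (− scale c 𝟏) n
  scale-𝟏-neg c n = sym (ℤ.neg-distribˡ-* c (𝟙 n))

  scale-𝟏-0 : ∀ n → scale 0ℤ 𝟏 n ≡ 𝟎 n
  scale-𝟏-0 n = ℤ.*-zeroˡ (𝟙 n)

  scale-𝟏-1 : ∀ n → scale 1ℤ 𝟏 n ≡ 𝟏 n
  scale-𝟏-1 n = ℤ.*-identityˡ (𝟙 n)

Series-commutativeRing : CommutativeRing 0ℓ 0ℓ
Series-commutativeRing = record
  { Carrier = Series ; _≈_ = _≋_ ; _+_ = _⊕_ ; _*_ = _·_ ; -_ = −_ ; 0# = 𝟎 ; 1# = 𝟏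
  ; isCommutativeRing = record
    { isRing = record
      { +-isAbelianGroup = record
        { isGroup = record
          { isMonoid = record
            { isSemigroup = record
              { isMagma = record
                { isEquivalence = record { refl = ≋-refl ; sym = ≋-sym ; trans = ≋-trans }
                ; ∙-cong = ⊕-cong }
              ; assoc = λ f g h → pointwise (⊕-assoc′ f g h) }
            ; identity = (λ f → pointwise (⊕-identityˡ′ f)) , (λ f → pointwise (⊕-identityʳ′ f)) }
          ; inverse = (λ f → pointwise (−-inverseˡ f)) , (λ f → pointwise (−-inverseʳ f))
          ; ⁻¹-cong = −-cong }
        ; comm = λ f g → pointwise (⊕-comm′ f g) }
      ; *-cong = ·-cong
      ; *-assoc = λ f g h → pointwise (·-assoc′ f g h)
      ; *-identity = (λ f → pointwise (·-identityˡ f)) ,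
          (λ f → pointwise (λ n → trans (·-comm′ f 𝟏 n) (·-identityˡ f n)))
      ; distrib = (λ f g h → pointwise (·-distribˡ f g h)) ,
          (λ h f g → pointwise (·-distribʳ f g h)) }
    ; *-comm = λ f g → pointwise (·-comm′ f g) } }

-- The clauses for 0 and 1 make the solver's constants unfold to 𝟎 and 𝟏.
κ : ℤ → Series
κ (+ 0) = 𝟎
κ (+ 1) = 𝟏
κ c     = scale c 𝟏

κ≋scale : ∀ c → κ c ≋ scale c 𝟏
κ≋scale (+ 0) = ≋-sym (pointwise scale-𝟏-0)
κ≋scale (+ 1) = ≋-sym (pointwise scale-𝟏-1)
κ≋scale (+ suc (suc _)) = ≋-refl
κ≋scale -[1+ _ ] = ≋-refl

κ-homomorphism : CommutativeRing.rawRing ℤ.+-*-commutativeRing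
  -Raw-AlmostCommutative⟶ fromCommutativeRing Series-commutativeRing
κ-homomorphism = record
  { ⟦_⟧ = κ
  ; +-homo = λ c d → ≋-trans (κ≋scale (c ℤ.+ d)) (≋-trans (pointwise (scale-𝟏-+ c d))
      (≋-sym (⊕-cong (κ≋scale c) (κ≋scale d))))
  ; *-homo = λ c d → ≋-trans (κ≋scale (c ℤ.* d)) (≋-trans (pointwise (scale-𝟏-* c d))
      (≋-sym (·-cong (κ≋scale c) (κ≋scale d))))
  ; -‿homo = λ c → ≋-trans (κ≋scale (ℤ.- c)) (≋-trans (pointwise (scale-𝟏-neg c))
      (≋-sym (−-cong (κ≋scale c))))
  ; 0-homo = ≋-refl
  ; 1-homo = ≋-refl }

κ-≟ : ∀ c d → Maybe (κ c ≋ κ d)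
κ-≟ c d with c ℤ.≟ d
... | yes refl = just ≋-refl
... | no  _    = nothing

open import Algebra.Solver.Ring (CommutativeRing.rawRing ℤ.+-*-commutativeRing)
  (fromCommutativeRing Series-commutativeRing) κ-homomorphism κ-≟
  using (solve; con; _:=_; _:+_; _:*_; _:-_; :-_; _:^_)

module ≋-Reasoning = SetoidReasoning (CommutativeRing.setoid Series-commutativeRing)

open import Algebra.Properties.CommutativeSemiring.Exp
  (CommutativeRing.commutativeSemiring Series-commutativeRing)
  using (^-homo-*; ^-assocʳ; ^-distrib-*) renaming (_^_ to _↑_)

-- Congruence modulo qᵏ.

infix 4 _≈[_]_
-- Truncation takes the place of q-adic limits: series that agree modulo every qᵏ are equal (`≈⇒≋`),
-- and modulo qᵏ the infinite products and sums below are finite.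
record _≈[_]_ (f : Series) (k : ℕ) (g : Series) : Set where
  constructor upto
  field below : ∀ m → m < k → f m ≡ g m
open _≈[_]_

≋⇒≈ : ∀ {f g k} → f ≋ g → f ≈[ k ] g
≋⇒≈ e .below m _ = at e m

≈⇒≋ : ∀ {f g} → (∀ k → f ≈[ k ] g) → f ≋ g
≈⇒≋ e .at m = below (e (suc m)) m ℕ.≤-refl

≈-refl : ∀ {f k} → f ≈[ k ] f
≈-refl = ≋⇒≈ ≋-refl

≈-sym : ∀ {f g k} → f ≈[ k ] g → g ≈[ k ] f
≈-sym e .below m l = sym (below e m l)

≈-trans : ∀ {f g h k} → f ≈[ k ] g → g ≈[ k ] h → f ≈[ k ] h
≈-trans e e′ .below m l = trans (below e m l) (below e′ m l)

≈-setoid : ℕ → Setoid 0ℓ 0ℓ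
≈-setoid k = record
  { Carrier = Series ; _≈_ = _≈[ k ]_
  ; isEquivalence = record { refl = ≈-refl ; sym = ≈-sym ; trans = ≈-trans } }

module ≈-Reasoning (k : ℕ) = SetoidReasoning (≈-setoid k)

≈-weaken : ∀ {f g j k} → j ≤ k → f ≈[ k ] g → f ≈[ j ] g
≈-weaken j≤k e .below m l = below e m (ℕ.<-≤-trans l j≤k)

opaque
  unfolding _·_

  ≈-⊕ : ∀ {f f′ g g′ k} → f ≈[ k ] f′ → g ≈[ k ] g′ → f ⊕ g ≈[ k ] f′ ⊕ g′
  ≈-⊕ e e′ .below m l = cong₂ ℤ._+_ (below e m l) (below e′ m l)

  ≈-− : ∀ {f f′ k} → f ≈[ k ] f′ → − f ≈[ k ] − f′
  ≈-− e .below m l = cong ℤ.-_ (below e m l)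

  ≈-· : ∀ {f f′ g g′ k} → f ≈[ k ] f′ → g ≈[ k ] g′ → f · g ≈[ k ] f′ · g′
  ≈-· e e′ .below m l = ·-cong-upto m
    (λ i i≤m → below e i (ℕ.≤-<-trans i≤m l)) (λ i i≤m → below e′ i (ℕ.≤-<-trans i≤m l))

  ·-vanish : ∀ {f g j k} → f ≈[ j ] 𝟎 → g ≈[ k ] 𝟎 → f · g ≈[ j + k ] 𝟎
  ·-vanish {f} {g} {j} {k} e e′ .below m =
    ⊛-vanishes {j} {k} {f} {g} (λ {i} → below e i) (λ {i} → below e′ i)

⊕-vanish : ∀ {f g k} → f ≈[ k ] 𝟎 → g ≈[ k ] 𝟎 → f ⊕ g ≈[ k ] 𝟎
⊕-vanish e e′ = ≈-trans (≈-⊕ e e′) (≋⇒≈ (solve 0 (con 0ℤ :+ con 0ℤ := con 0ℤ) ≋-refl))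

−-vanish : ∀ {f k} → f ≈[ k ] 𝟎 → − f ≈[ k ] 𝟎
−-vanish e = ≈-trans (≈-− e) (≋⇒≈ (solve 0 (:- con 0ℤ := con 0ℤ) ≋-refl))

·-vanishˡ : ∀ {f} g {k} → f ≈[ k ] 𝟎 → f · g ≈[ k ] 𝟎
·-vanishˡ g e = ≈-trans (≈-· e ≈-refl) (≋⇒≈ (solve 1 (λ g → con 0ℤ :* g := con 0ℤ) ≋-refl g))

·-vanishʳ : ∀ f {g k} → g ≈[ k ] 𝟎 → f · g ≈[ k ] 𝟎
·-vanishʳ f e = ≈-trans (≈-· ≈-refl e) (≋⇒≈ (solve 1 (λ g → g :* con 0ℤ := con 0ℤ) ≋-refl f))

difference-vanish : ∀ {f g k} → f ≈[ k ] g → f ⊕ − g ≈[ k ] 𝟎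
difference-vanish {g = g} e = ≈-trans (≈-⊕ e ≈-refl) (≋⇒≈ (solve 1 (λ g → g :- g := con 0ℤ) ≋-refl g))

-- Powers of a series without constant term tend to 0 q-adically, which makes the infinite products
-- with such a base converge.
Small : Series → Set
Small f = f ≈[ 1 ] 𝟎

vanish-0 : ∀ {f} → f ≈[ 0 ] 𝟎
vanish-0 .below m ()

↑-vanish : ∀ {p} → Small p → ∀ n → p ↑ n ≈[ n ] 𝟎
↑-vanish sp zero = vanish-0
↑-vanish sp (suc n) = ·-vanish sp (↑-vanish sp n)

·↑-vanish : ∀ a {p} → Small p → ∀ n → a · p ↑ n ≈[ n ] 𝟎
·↑-vanish a sp n = ·-vanishʳ a (↑-vanish sp n)

↑-cong : ∀ {p p′} n → p ≋ p′ → p ↑ n ≋ p′ ↑ n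
↑-cong zero e = ≋-refl
↑-cong (suc n) e = ·-cong e (↑-cong n e)

↑-≈ : ∀ {p p′ k} n → p ≈[ k ] p′ → p ↑ n ≈[ k ] p′ ↑ n
↑-≈ zero e = ≈-refl
↑-≈ (suc n) e = ≈-· e (↑-≈ n e)

square-↑ : ∀ p n → (p · p) ↑ n ≋ p ↑ n · p ↑ n
square-↑ p zero = solve 0 (con 1ℤ := con 1ℤ :* con 1ℤ) ≋-refl
square-↑ p (suc n) = ≋-trans (·-cong ≋-refl (square-↑ p n))
  (solve 2 (λ p r → p :* p :* (r :* r) := p :* r :* (p :* r)) ≋-refl p (p ↑ n))

one-minus : ∀ {f k} → f ≈[ k ] 𝟎 → 𝟏 ⊕ − f ≈[ k ] 𝟏
one-minus e = ≈-trans (≈-⊕ ≈-refl (−-vanish e)) (≋⇒≈ (solve 0 (con 1ℤ :+ con 0ℤ := con 1ℤ) ≋-refl))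

-- Finite and infinite q-products.

poch : Series → Series → ℕ → Series
poch a p zero = 𝟏
poch a p (suc n) = poch a p n · (𝟏 ⊕ − (a · p ↑ n))

poch-≈ : ∀ {a a′ p p′ k} n → a ≈[ k ] a′ → p ≈[ k ] p′ → poch a p n ≈[ k ] poch a′ p′ n
poch-≈ zero e e′ = ≈-refl
poch-≈ (suc n) e e′ = ≈-· (poch-≈ n e e′) (≈-⊕ ≈-refl (≈-− (≈-· e (↑-≈ n e′))))

poch-stable : ∀ a {p} → Small p → ∀ n d → poch a p (d + n) ≈[ n ] poch a p n
poch-stable a sp n zero = ≈-refl
poch-stable a {p} sp n (suc d) = begin
  poch a p (d + n) · (𝟏 ⊕ − (a · p ↑ (d + n)))
    ≈⟨ ≈-· (poch-stable a sp n d)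
         (one-minus (≈-weaken (ℕ.m≤n+m n d) (·↑-vanish a sp (d + n)))) ⟩
  poch a p n · 𝟏
    ≈⟨ ≋⇒≈ (solve 1 (λ x → x :* con 1ℤ := x) ≋-refl (poch a p n)) ⟩
  poch a p n ∎
  where open ≈-Reasoning n

poch-head : ∀ a p n → poch a p (suc n) ≋ (𝟏 ⊕ − a) · poch (a · p) p n
poch-head a p zero =
  solve 1 (λ a → con 1ℤ :* (con 1ℤ :- a :* con 1ℤ) := (con 1ℤ :- a) :* con 1ℤ) ≋-refl a
poch-head a p (suc n) = ≋-trans (·-cong (poch-head a p n) ≋-refl)
  (solve 4 (λ a p r x → (con 1ℤ :- a) :* x :* (con 1ℤ :- a :* (p :* r)) :=
      (con 1ℤ :- a) :* (x :* (con 1ℤ :- a :* p :* r))) ≋-refl a p (p ↑ n) (poch (a · p) p n))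

-- E a p is the infinite product (a;p)_∞.
opaque
  E : Series → Series → Series
  E a p m = poch a p (suc m) m

  E-≈poch : ∀ a {p} → Small p → ∀ k → E a p ≈[ k ] poch a p k
  E-≈poch a {p} sp k .below m m<k = sym (trans
    (cong (λ i → poch a p i m) (sym (ℕ.m∸n+n≡m m<k)))
    (below (poch-stable a sp (suc m) (k ∸ suc m)) m ℕ.≤-refl))

  E-≈ : ∀ {a a′ p p′ k} → a ≈[ k ] a′ → p ≈[ k ] p′ → E a p ≈[ k ] E a′ p′
  E-≈ e e′ .below m = below (poch-≈ (suc m) e e′) m

E-cong : ∀ {a a′ p p′} → a ≋ a′ → p ≋ p′ → E a p ≋ E a′ p′
E-cong e e′ = ≈⇒≋ λ k → E-≈ (≋⇒≈ e) (≋⇒≈ e′)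

poch-𝟎 : ∀ p n → poch 𝟎 p n ≋ 𝟏
poch-𝟎 p zero = ≋-refl
poch-𝟎 p (suc n) = ≋-trans (·-cong (poch-𝟎 p n) ≋-refl)
  (solve 1 (λ r → con 1ℤ :* (con 1ℤ :- con 0ℤ :* r) := con 1ℤ) ≋-refl (p ↑ n))

E-𝟎 : ∀ {p} → Small p → E 𝟎 p ≋ 𝟏
E-𝟎 {p} sp = ≈⇒≋ λ k → ≈-trans (E-≈poch 𝟎 sp k) (≋⇒≈ (poch-𝟎 p k))

E-≈𝟏 : ∀ {a p k} → Small p → a ≈[ k ] 𝟎 → E a p ≈[ k ] 𝟏
E-≈𝟏 sp e = ≈-trans (E-≈ e ≈-refl) (≋⇒≈ (E-𝟎 sp))

E-head : ∀ a {p} → Small p → E a p ≋ (𝟏 ⊕ − a) · E (a · p) p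
E-head a {p} sp = ≈⇒≋ λ k → ≈-trans (≈-weaken (ℕ.n≤1+n k) (E-≈poch a sp (suc k)))
  (≈-trans (≋⇒≈ (poch-head a p k)) (≈-· ≈-refl (≈-sym (E-≈poch (a · p) sp k))))

E-head↑ : ∀ a {p} → Small p → ∀ n →
  E (a · p ↑ n) p ≋ (𝟏 ⊕ − (a · p ↑ n)) · E (a · p ↑ suc n) p
E-head↑ a {p} sp n = ≋-trans (E-head (a · p ↑ n) sp) (·-cong ≋-refl (E-cong
  (solve 3 (λ a p r → a :* r :* p := a :* (p :* r)) ≋-refl a p (p ↑ n)) ≋-refl))

-- Iteration gives F 0 = (a;p)ₙ · F n, and both factors converge. With F n the value of a function
-- at a pⁿ, this solves a functional equation under a ↦ a p.
E-limit : ∀ {a p L} → Small p → (F : ℕ → Series) →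
  (∀ n → F n ≋ (𝟏 ⊕ − (a · p ↑ n)) · F (suc n)) → (∀ n → F n ≈[ n ] L) → F 0 ≋ E a p · L
E-limit {a} {p} {L} sp F step lim = ≈⇒≋ λ k →
  ≈-trans (≋⇒≈ (unroll k)) (≈-· (≈-sym (E-≈poch a sp k)) (lim k))
  where
  unroll : ∀ n → F 0 ≋ poch a p n · F n
  unroll zero = solve 1 (λ x → x := con 1ℤ :* x) ≋-refl (F 0)
  unroll (suc n) = ≋-trans (unroll n) (≋-trans (·-cong ≋-refl (step n))
    (solve 3 (λ x y z → x :* (y :* z) := x :* y :* z) ≋-refl _ _ _))

-- The factors now accumulate upwards: F n = (a;p)ₙ · F 0, and the limit is the unknown.
E-colimit : ∀ {a p L} → Small p → (F : ℕ → Series) →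
  (∀ n → F (suc n) ≋ (𝟏 ⊕ − (a · p ↑ n)) · F n) → (∀ n → F n ≈[ n ] L) → L ≋ E a p · F 0
E-colimit {a} {p} {L} sp F step lim = ≈⇒≋ λ k →
  ≈-trans (≈-sym (lim k)) (≈-trans (≋⇒≈ (unroll k)) (≈-· (≈-sym (E-≈poch a sp k)) ≈-refl))
  where
  unroll : ∀ n → F n ≋ poch a p n · F 0
  unroll zero = solve 1 (λ x → x := con 1ℤ :* x) ≋-refl (F 0)
  unroll (suc n) = ≋-trans (step n) (≋-trans (·-cong ≋-refl (unroll n))
    (solve 3 (λ x y z → x :* (y :* z) := y :* x :* z) ≋-refl _ _ _))

·𝟏 : ∀ f → f · 𝟏 ≋ f
·𝟏 f = solve 1 (λ x → x :* con 1ℤ := x) ≋-refl f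

≈-·𝟏 : ∀ {f g k} → f ≈[ k ] 𝟏 → g ≈[ k ] 𝟏 → f · g ≈[ k ] 𝟏
≈-·𝟏 e e′ = ≈-trans (≈-· e e′) (≋⇒≈ (·𝟏 𝟏))

·-small : ∀ {f} g → Small f → Small (f · g)
·-small g = ·-vanishˡ g

E-double : ∀ a {p} → Small p → E a p ≋ E a (p · p) · E (a · p) (p · p)
E-double a {p} sp = ≋-sym (≋-trans
  (·-cong (E-cong (≋-sym (·𝟏 a)) ≋-refl) (E-cong (·-cong ≋-refl (≋-sym (·𝟏 p))) ≋-refl))
  (≋-trans (E-limit sp F step (λ n → ≈-·𝟏 (E-≈𝟏 spp (·↑-vanish a sp n))
     (E-≈𝟏 spp (≈-weaken (ℕ.n≤1+n n) (·↑-vanish a sp (suc n)))))) (·𝟏 (E a p))))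
  where
  spp = ·-small p sp
  F : ℕ → Series
  F n = E (a · p ↑ n) (p · p) · E (a · p ↑ suc n) (p · p)
  step : ∀ n → F n ≋ (𝟏 ⊕ − (a · p ↑ n)) · F (suc n)
  -- Removing the first factor of the left product turns the pair for `n` into the pair for `suc n`
  -- in exchanged order.
  step n = ≋-trans (·-cong (≋-trans (E-head _ spp) (·-cong ≋-refl (E-cong
      (solve 3 (λ a p r → a :* r :* (p :* p) := a :* (p :* (p :* r))) ≋-refl a p (p ↑ n))
      ≋-refl))) ≋-refl)
    (solve 3 (λ x y z → x :* y :* z := x :* (z :* y)) ≋-refl _ _ _)

E-triple : ∀ a {p} → Small p →
  E a p ≋ E a (p · p · p) · E (a · p) (p · p · p) · E (a · (p · p)) (p · p · p)
E-triple a {p} sp = ≋-sym (≋-trans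
  (·-cong (·-cong (E-cong (≋-sym (·𝟏 a)) ≋-refl) (E-cong (·-cong ≋-refl (≋-sym (·𝟏 p))) ≋-refl))
     (E-cong (·-cong ≋-refl (·-cong ≋-refl (≋-sym (·𝟏 p)))) ≋-refl))
  (≋-trans (E-limit sp F step (λ n → ≈-·𝟏 (≈-·𝟏 (E-≈𝟏 sppp (·↑-vanish a sp n))
     (E-≈𝟏 sppp (≈-weaken (ℕ.n≤1+n n) (·↑-vanish a sp (suc n)))))
     (E-≈𝟏 sppp (≈-weaken (ℕ.m≤n+m n 2) (·↑-vanish a sp (suc (suc n)))))))
     (·𝟏 (E a p))))
  where
  sppp = ·-small p (·-small p sp)
  F : ℕ → Series
  F n = E (a · p ↑ n) (p · p · p) · E (a · p ↑ suc n) (p · p · p) · E (a · p ↑ suc (suc n)) (p · p · p)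
  step : ∀ n → F n ≋ (𝟏 ⊕ − (a · p ↑ n)) · F (suc n)
  step n = ≋-trans (·-cong (·-cong (≋-trans (E-head _ sppp) (·-cong ≋-refl (E-cong
      (solve 3 (λ a p r → a :* r :* (p :* p :* p) := a :* (p :* (p :* (p :* r))))
        ≋-refl a p (p ↑ n))
      ≋-refl))) ≋-refl) ≋-refl)
    (solve 4 (λ x y z t → x :* y :* z :* t := x :* (z :* t :* y)) ≋-refl _ _ _ _)

E-conjugate : ∀ a {p} → Small p → E a p · E (− a) p ≋ E (a · a) (p · p)
E-conjugate a {p} sp = ≋-trans
  (·-cong (E-cong (≋-sym (·𝟏 a)) ≋-refl) (E-cong (≋-sym (·𝟏 (− a))) ≋-refl))
  (≋-trans (E-limit (·-small p sp) F step
      (λ n → ≈-·𝟏 (E-≈𝟏 sp (·↑-vanish a sp n)) (E-≈𝟏 sp (·↑-vanish (− a) sp n))))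
    (·𝟏 _))
  where
  F : ℕ → Series
  F n = E (a · p ↑ n) p · E (− a · p ↑ n) p
  step : ∀ n → F n ≋ (𝟏 ⊕ − (a · a · (p · p) ↑ n)) · F (suc n)
  step n = ≋-trans (·-cong (E-head↑ a sp n) (E-head↑ (− a) sp n))
    (≋-trans (solve 4 (λ a r x y → (con 1ℤ :- a :* r) :* x :* ((con 1ℤ :- (:- a) :* r) :* y) :=
        (con 1ℤ :- a :* a :* (r :* r)) :* (x :* y)) ≋-refl a (p ↑ n) _ _)
      (·-cong (⊕-cong ≋-refl (−-cong (·-cong ≋-refl (≋-sym (square-↑ p n))))) ≋-refl))

-- Infinite sums of series.

psum : ℕ → (ℕ → Series) → Series
psum zero F = 𝟎
psum (suc N) F = F 0 ⊕ psum N (F ∘ suc)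

-- Σ∞ F reads only F 0, …, F m in its coefficient of qᵐ, so it is the sum of F only
-- for such families.
Summable : (ℕ → Series) → Set
Summable F = ∀ n → F n ≈[ n ] 𝟎

opaque
  unfolding _·_

  ∑ : (ℕ → Series) → Series
  ∑ = Σ∞

  ∑≡Σ∞ : ∀ F → ∑ F ≡ Σ∞ F
  ∑≡Σ∞ F = refl

  psum≡sum : ∀ N F m → psum N F m ≡ ℤSum.sum {N} (λ i → F (toℕ i) m)
  psum≡sum zero F m = refl
  psum≡sum (suc N) F m = cong (ℤ._+_ (F 0 m)) (psum≡sum N (F ∘ suc) m)

  ∑-coefficient : ∀ F m → ∑ F m ≡ psum (suc m) F m
  ∑-coefficient F m = sym (psum≡sum (suc m) F m)

psum-vanish : ∀ {k} N F → (∀ n → F n ≈[ k ] 𝟎) → psum N F ≈[ k ] 𝟎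
psum-vanish zero F v = ≈-refl
psum-vanish (suc N) F v = ⊕-vanish (v 0) (psum-vanish N (F ∘ suc) (v ∘ suc))

psum-≈ : ∀ {k} N {F G} → (∀ n → F n ≈[ k ] G n) → psum N F ≈[ k ] psum N G
psum-≈ zero e = ≈-refl
psum-≈ (suc N) e = ≈-⊕ (e 0) (psum-≈ N (e ∘ suc))

psum-split : ∀ M N F → psum (M + N) F ≋ psum M F ⊕ psum N (λ n → F (M + n))
psum-split zero N F = solve 1 (λ x → x := con 0ℤ :+ x) ≋-refl _
psum-split (suc M) N F = ≋-trans (⊕-cong ≋-refl (psum-split M N (F ∘ suc)))
  (solve 3 (λ x y z → x :+ (y :+ z) := x :+ y :+ z) ≋-refl _ _ _)

psum-⊕ : ∀ N F G → psum N (λ n → F n ⊕ G n) ≋ psum N F ⊕ psum N G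
psum-⊕ zero F G = solve 0 (con 0ℤ := con 0ℤ :+ con 0ℤ) ≋-refl
psum-⊕ (suc N) F G = ≋-trans (⊕-cong ≋-refl (psum-⊕ N (F ∘ suc) (G ∘ suc)))
  (solve 4 (λ x y z t → x :+ y :+ (z :+ t) := x :+ z :+ (y :+ t)) ≋-refl _ _ _ _)

psum-· : ∀ c N F → c · psum N F ≋ psum N (λ n → c · F n)
psum-· c zero F = solve 1 (λ x → x :* con 0ℤ := con 0ℤ) ≋-refl c
psum-· c (suc N) F = ≋-trans (solve 3 (λ c x y → c :* (x :+ y) := c :* x :+ c :* y) ≋-refl _ _ _)
  (⊕-cong ≋-refl (psum-· c N (F ∘ suc)))

psum-stable : ∀ {F} → Summable F → ∀ k d → psum (k + d) F ≈[ k ] psum k F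
psum-stable {F} v k d = begin
  psum (k + d) F                            ≈⟨ ≋⇒≈ (psum-split k d F) ⟩
  psum k F ⊕ psum d (λ n → F (k + n))
    ≈⟨ ≈-⊕ ≈-refl (psum-vanish d _ (λ n → ≈-weaken (ℕ.m≤m+n k n) (v (k + n)))) ⟩
  psum k F ⊕ 𝟎  ≈⟨ ≋⇒≈ (solve 1 (λ x → x :+ con 0ℤ := x) ≋-refl _) ⟩
  psum k F      ∎
  where open ≈-Reasoning k

∑-≈psum : ∀ {F} → Summable F → ∀ k → ∑ F ≈[ k ] psum k F
∑-≈psum {F} v k .below m m<k = trans (∑-coefficient F m) (sym (trans
  (cong (λ i → psum i F m) (sym (ℕ.m+[n∸m]≡n m<k)))
  (below (psum-stable v (suc m) (k ∸ suc m)) m ℕ.≤-refl)))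

∑-≈ : ∀ {k F G} → (∀ n → F n ≈[ k ] G n) → ∑ F ≈[ k ] ∑ G
∑-≈ {k} {F} {G} e .below m m<k = trans (∑-coefficient F m)
  (trans (below (psum-≈ (suc m) e) m m<k) (sym (∑-coefficient G m)))

∑-vanish : ∀ {k F} → (∀ n → F n ≈[ k ] 𝟎) → ∑ F ≈[ k ] 𝟎
∑-vanish {F = F} v .below m m<k = trans (∑-coefficient F m) (below (psum-vanish (suc m) F v) m m<k)

∑-cong : ∀ {F G} → (∀ n → F n ≋ G n) → ∑ F ≋ ∑ G
∑-cong e = ≈⇒≋ λ k → ∑-≈ (λ n → ≋⇒≈ (e n))

∑-⊕ : ∀ F G → ∑ (λ n → F n ⊕ G n) ≋ ∑ F ⊕ ∑ G
∑-⊕ F G .at m = trans (∑-coefficient _ m) (trans (at (psum-⊕ (suc m) F G) m)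
  (trans (⊕-at (psum (suc m) F) _ m) (trans (sym (cong₂ ℤ._+_ (∑-coefficient F m) (∑-coefficient G m)))
    (sym (⊕-at (∑ F) (∑ G) m)))))

∑-· : ∀ c {F} → Summable F → c · ∑ F ≋ ∑ (λ n → c · F n)
∑-· c {F} v = ≈⇒≋ λ k → ≈-trans (≈-· ≈-refl (∑-≈psum v k))
  (≈-trans (≋⇒≈ (psum-· c k F)) (≈-sym (∑-≈psum (λ n → ·-vanishʳ c (v n)) k)))

∑-head : ∀ {F} → Summable F → ∑ F ≋ F 0 ⊕ ∑ (F ∘ suc)
∑-head {F} v = ≈⇒≋ λ k → ≈-trans (≈-weaken (ℕ.n≤1+n k) (∑-≈psum v (suc k)))
  (≈-⊕ ≈-refl (≈-sym (∑-≈psum (λ n → ≈-weaken (ℕ.n≤1+n n) (v (suc n))) k)))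

psum-pairs : ∀ N F → psum (N * 2) F ≋ psum N (λ k → F (k * 2) ⊕ F (suc (k * 2)))
psum-pairs zero F = ≋-refl
psum-pairs (suc N) F = ≋-trans (⊕-cong ≋-refl (⊕-cong ≋-refl (psum-pairs N (F ∘ suc ∘ suc))))
  (solve 3 (λ x y z → x :+ (y :+ z) := x :+ y :+ z) ≋-refl _ _ _)

∑-pairs : ∀ {F} → Summable F → ∑ F ≋ ∑ (λ k → F (k * 2) ⊕ F (suc (k * 2)))
∑-pairs {F} v = ≈⇒≋ λ k → ≈-trans (≈-weaken (ℕ.m≤m*n k 2) (∑-≈psum v (k * 2)))
  (≈-trans (≋⇒≈ (psum-pairs k F)) (≈-sym (∑-≈psum (λ n → ⊕-vanish
    (≈-weaken (ℕ.m≤m*n n 2) (v (n * 2)))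
    (≈-weaken (ℕ.m≤n⇒m≤1+n (ℕ.m≤m*n n 2)) (v (suc (n * 2))))) k)))

psum-telescope : ∀ N (M : ℕ → Series) → psum N (λ n → M n ⊕ − M (suc n)) ≋ M 0 ⊕ − M N
psum-telescope zero M = solve 1 (λ x → con 0ℤ := x :- x) ≋-refl (M 0)
psum-telescope (suc N) M = ≋-trans (⊕-cong ≋-refl (psum-telescope N (M ∘ suc)))
  (solve 3 (λ x y z → (x :- y) :+ (y :- z) := x :- z) ≋-refl _ _ _)

∑-telescope : ∀ {M} → Summable M → ∑ (λ n → M n ⊕ − M (suc n)) ≋ M 0
∑-telescope {M} v = ≈⇒≋ λ k → ≈-trans (∑-≈psum summable k) (≈-trans (≋⇒≈ (psum-telescope k M))
  (≈-trans (≈-⊕ ≈-refl (−-vanish (v k))) (≋⇒≈ (solve 1 (λ x → x :+ con 0ℤ := x) ≋-refl (M 0)))))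
  where
  summable : Summable (λ n → M n ⊕ − M (suc n))
  summable n = ⊕-vanish (v n) (−-vanish (≈-weaken (ℕ.n≤1+n n) (v (suc n))))

-- Theta series and Jacobi's triple product.

-- In closed form aʲ p^{j(j-1)/2}.
α : Series → Series → ℕ → Series
α a p zero = 𝟏
α a p (suc j) = a · p ↑ j · α a p j

α-≈ : ∀ {a a′ p p′ k} j → a ≈[ k ] a′ → p ≈[ k ] p′ → α a p j ≈[ k ] α a′ p′ j
α-≈ zero e e′ = ≈-refl
α-≈ (suc j) e e′ = ≈-· (≈-· e (↑-≈ j e′)) (α-≈ j e e′)

α-vanish : ∀ a {p} → Small p → ∀ j → α a p (suc j) ≈[ j ] 𝟎
α-vanish a sp j = ·-vanishˡ _ (·↑-vanish a sp j)

α-summable : ∀ {a p} → Small a → Small p → Summable (α a p)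
α-summable sa sp zero = vanish-0
α-summable sa sp (suc j) = ·-vanishˡ _ (·-vanish sa (↑-vanish sp j))

-- With p = ab, the terms of index j and - j of the bilateral sum
-- Σ_{j ∈ ℤ} a^{j(j+1)/2} b^{j(j-1)/2} are α a p j and α b p j.
θ-term : Series → Series → ℕ → Series
θ-term a b j = α a (a · b) j ⊕ α b (a · b) (suc j)

θ : Series → Series → Series
θ a b = ∑ (θ-term a b)

-- Only `a` has to be small; `b` is 𝟏 in `Ψ`. The term α b p (j + 1) contains pʲ, which suffices.
θ-summable : ∀ {a} b → Small a → Summable (θ-term a b)
θ-summable {a} b sa n = ⊕-vanish (α-summable sa (·-small b sa) n) (α-vanish b (·-small b sa) n)

θ-cong : ∀ {a a′ b b′} → a ≋ a′ → b ≋ b′ → θ a b ≋ θ a′ b′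
θ-cong e e′ = ≈⇒≋ λ k → ∑-≈ λ n → ≈-⊕
  (α-≈ n (≋⇒≈ e) (≋⇒≈ (·-cong e e′))) (α-≈ (suc n) (≋⇒≈ e′) (≋⇒≈ (·-cong e e′)))

-- Λ n s is the sum over k of t_{k-n} s_k, where t_j is the term of index j of
-- the bilateral sum of θ a b.
Λ : Series → Series → ℕ → (ℕ → Series) → Series
Λ a b zero s = ∑ (λ k → α a (a · b) k · s k)
Λ a b (suc n) s = α b (a · b) (suc n) · s 0 ⊕ Λ a b n (s ∘ suc)

module TripleProduct {a : Series} (b : Series) (sa : Small a) where

  p : Series
  p = a · b

  sp : Small p
  sp = ·-small b sa

  summable : ∀ (s : ℕ → Series) → Summable (λ k → α a p k · s k)
  summable s k = ·-vanishˡ (s k) (α-summable sa sp k)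

  Λ-≈ : ∀ n {s s′ k} → (∀ j → s j ≈[ k ] s′ j) → Λ a b n s ≈[ k ] Λ a b n s′
  Λ-≈ zero e = ∑-≈ λ j → ≈-· ≈-refl (e j)
  Λ-≈ (suc n) e = ≈-⊕ (≈-· ≈-refl (e 0)) (Λ-≈ n (e ∘ suc))

  Λ-⊕ : ∀ n s s′ → Λ a b n (λ k → s k ⊕ s′ k) ≋ Λ a b n s ⊕ Λ a b n s′
  Λ-⊕ zero s s′ = ≋-trans
    (∑-cong λ k → solve 3 (λ x y z → x :* (y :+ z) := x :* y :+ x :* z) ≋-refl (α a p k) (s k) (s′ k))
    (∑-⊕ _ _)
  Λ-⊕ (suc n) s s′ = ≋-trans (⊕-cong ≋-refl (Λ-⊕ n (s ∘ suc) (s′ ∘ suc)))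
    (solve 5 (λ x y z t u → x :* (y :+ z) :+ (t :+ u) := x :* y :+ t :+ (x :* z :+ u)) ≋-refl _ _ _ _ _)

  Λ-· : ∀ n c s → Λ a b n (λ k → c · s k) ≋ c · Λ a b n s
  Λ-· zero c s = ≋-trans
    (∑-cong λ k → solve 3 (λ x c y → x :* (c :* y) := c :* (x :* y)) ≋-refl (α a p k) c (s k))
    (≋-sym (∑-· c (summable s)))
  Λ-· (suc n) c s = ≋-trans (⊕-cong ≋-refl (Λ-· n c (s ∘ suc)))
    (solve 4 (λ x c y z → x :* (c :* y) :+ c :* z := c :* (x :* y :+ z)) ≋-refl _ _ _ _)

  -- The bilateral terms satisfy t_{j+1} = a pʲ t_j for all integers j. As p = ab, this gives pᵏ
  -- t_{k-n-1} = b pⁿ t_{k-n}.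
  Λ-scaled : ∀ n s → Λ a b (suc n) (λ k → p ↑ k · s k) ≋ b · p ↑ n · Λ a b n s
  Λ-scaled zero s = begin
    b · 𝟏 · 𝟏 · (𝟏 · s 0) ⊕ ∑ (λ k → α a p k · (p · p ↑ k · s (suc k)))
      ≈⟨ ⊕-cong ≋-refl (≋-trans
          (∑-cong λ k → solve 5 (λ a b x r y → x :* (a :* b :* r :* y) := b :* (a :* r :* x :* y))
            ≋-refl a b (α a p k) (p ↑ k) (s (suc k)))
          (≋-sym (∑-· b (λ k → ≈-weaken (ℕ.n≤1+n k) (summable s (suc k)))))) ⟩
    b · 𝟏 · 𝟏 · (𝟏 · s 0) ⊕ b · ∑ (λ k → α a p (suc k) · s (suc k))
      ≈⟨ solve 3 (λ b x y → b :* con 1ℤ :* con 1ℤ :* (con 1ℤ :* x) :+ b :* y :=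
          b :* con 1ℤ :* (con 1ℤ :* x :+ y)) ≋-refl b (s 0) _ ⟩
    b · 𝟏 · (𝟏 · s 0 ⊕ ∑ (λ k → α a p (suc k) · s (suc k)))
      ≈⟨ ·-cong ≋-refl (∑-head (summable s)) ⟨
    b · 𝟏 · ∑ (λ k → α a p k · s k) ∎
    where open ≋-Reasoning
  Λ-scaled (suc n) s = begin
    b · p ↑ suc n · α b p (suc n) · (𝟏 · s 0) ⊕ Λ a b (suc n) (λ k → p · p ↑ k · s (suc k))
      ≈⟨ ⊕-cong ≋-refl (≋-trans (≈⇒≋ λ k → Λ-≈ (suc n) λ j → ≋⇒≈
          (solve 3 (λ p r y → p :* r :* y := p :* (r :* y)) ≋-refl p (p ↑ j) (s (suc j))))
          (≋-trans (Λ-· (suc n) p (λ k → p ↑ k · s (suc k))) (·-cong ≋-refl (Λ-scaled n (s ∘ suc))))) ⟩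
    b · p ↑ suc n · α b p (suc n) · (𝟏 · s 0) ⊕ p · (b · p ↑ n · Λ a b n (s ∘ suc))
      ≈⟨ solve 6 (λ b p r x y z → b :* (p :* r) :* x :* (con 1ℤ :* y) :+ p :* (b :* r :* z) :=
          b :* (p :* r) :* (x :* y :+ z)) ≋-refl b p (p ↑ n) _ (s 0) _ ⟩
    b · p ↑ suc n · (α b p (suc n) · s 0 ⊕ Λ a b n (s ∘ suc)) ∎
    where open ≋-Reasoning

  -- For j < n the term t_{j-n} contains p^{n-j-1}, which together with the j + k + 1 factors q in
  -- s_j makes n + k. For j ≥ n the factor s_j alone is enough.
  Λ-vanish : ∀ n {s k} → (∀ j → s j ≈[ suc (j + k) ] 𝟎) → Λ a b n s ≈[ n + k ] 𝟎
  Λ-vanish zero {s} {k} v =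
    ∑-vanish λ j → ·-vanishʳ _ (≈-weaken (ℕ.m≤n⇒m≤1+n (ℕ.m≤n+m k j)) (v j))
  Λ-vanish (suc n) {s} {k} v = ⊕-vanish
    (≈-weaken (ℕ.≤-reflexive (sym (ℕ.+-suc n k))) (·-vanish (α-vanish b sp n) (v 0)))
    (≈-weaken (ℕ.≤-reflexive (sym (ℕ.+-suc n k))) (Λ-vanish n
      (λ j → ≈-weaken (ℕ.≤-reflexive (cong suc (ℕ.+-suc j k))) (v (suc j)))))

  Λ-𝟏 : ∀ n → Λ a b n (λ _ → 𝟏) ≋ ∑ (α a p) ⊕ psum n (λ j → α b p (suc j))
  Λ-𝟏 zero = ≋-trans (∑-cong λ k → ·𝟏 _) (solve 1 (λ x → x := x :+ con 0ℤ) ≋-refl _)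
  Λ-𝟏 (suc n) = ≋-trans (⊕-cong ≋-refl (Λ-𝟏 n)) (≋-trans
    (solve 3 (λ x y z → x :* con 1ℤ :+ (y :+ z) := y :+ (z :+ x)) ≋-refl _ _ _)
    (⊕-cong ≋-refl (psum-last n _)))
    where
    psum-last : ∀ n F → psum n F ⊕ F n ≋ psum (suc n) F
    psum-last zero F = solve 1 (λ x → con 0ℤ :+ x := x :+ con 0ℤ) ≋-refl _
    psum-last (suc n) F = ≋-trans (solve 3 (λ x y z → x :+ y :+ z := x :+ (y :+ z)) ≋-refl _ _ _)
      (⊕-cong ≋-refl (psum-last n (F ∘ suc)))

  -- The constant sequence 𝟏 yields a truncation of the bilateral sum (`Λ-𝟏`); the rest, s - 𝟏,
  -- contributes nothing below qⁿ (`Λ-vanish`).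
  Λ-limit : ∀ {s} → (∀ j → s j ≈[ suc j ] 𝟏) → ∀ n → Λ a b n s ≈[ n ] θ a b
  Λ-limit {s} e n = begin
    Λ a b n s
      ≈⟨ Λ-≈ n (λ j → ≋⇒≈ (solve 1 (λ x → x := x :- con 1ℤ :+ con 1ℤ) ≋-refl (s j))) ⟩
    Λ a b n (λ j → s j ⊕ − 𝟏 ⊕ 𝟏)
      ≈⟨ ≋⇒≈ (Λ-⊕ n _ _) ⟩
    Λ a b n (λ j → s j ⊕ − 𝟏) ⊕ Λ a b n (λ _ → 𝟏)
      ≈⟨ ≈-⊕ (≈-weaken (ℕ.m≤m+n n 0) (Λ-vanish n λ j →
          ≈-weaken (ℕ.≤-reflexive (cong suc (ℕ.+-identityʳ j))) (difference-vanish (e j))))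
          (≋⇒≈ (Λ-𝟏 n)) ⟩
    𝟎 ⊕ (∑ (α a p) ⊕ psum n (λ j → α b p (suc j)))
      ≈⟨ ≋⇒≈ (solve 1 (λ x → con 0ℤ :+ x := x) ≋-refl _) ⟩
    ∑ (α a p) ⊕ psum n (λ j → α b p (suc j))
      ≈⟨ ≈-⊕ ≈-refl (∑-≈psum (α-vanish b sp) n) ⟨
    ∑ (α a p) ⊕ ∑ (λ j → α b p (suc j))
      ≈⟨ ≋⇒≈ (∑-⊕ _ _) ⟨
    θ a b ∎
    where open ≈-Reasoning n

  -- (p;p)_∞ / (p;p)_k
  f : ℕ → Series
  f k = E (p · p ↑ k) p

  f-≈𝟏 : ∀ k → f k ≈[ suc k ] 𝟏
  f-≈𝟏 k = E-≈𝟏 sp (↑-vanish sp (suc k))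

  shift : (ℕ → Series) → ℕ → Series
  -- With this value f_{k-1} = (1 - pᵏ) f_k also holds at k = 0, where the factor is 0.
  shift s zero = 𝟎
  shift s (suc k) = s k

  f-split : ∀ k → f k ≋ shift f k ⊕ p ↑ k · f k
  f-split zero = solve 1 (λ x → x := con 0ℤ :+ con 1ℤ :* x) ≋-refl _
  f-split (suc k) = ≋-trans
    (solve 2 (λ r x → x := (con 1ℤ :- r) :* x :+ r :* x) ≋-refl (p ↑ suc k) (f (suc k)))
    (⊕-cong (≋-sym (E-head↑ p sp k)) ≋-refl)

  -- Of the two parts in `f-split`, the shifted one lowers the index of Λ by one and the one with pᵏ
  -- is handled by `Λ-scaled`.
  Λ-step : ∀ n → Λ a b (suc n) f ≋ (𝟏 ⊕ − (− b · p ↑ n)) · Λ a b n f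
  Λ-step n = begin
    Λ a b (suc n) f
      ≈⟨ (≈⇒≋ λ k → Λ-≈ (suc n) λ j → ≋⇒≈ (f-split j)) ⟩
    Λ a b (suc n) (λ k → shift f k ⊕ p ↑ k · f k)
      ≈⟨ Λ-⊕ (suc n) (shift f) (λ k → p ↑ k · f k) ⟩
    α b p (suc n) · 𝟎 ⊕ Λ a b n f ⊕ Λ a b (suc n) (λ k → p ↑ k · f k)
      ≈⟨ ⊕-cong ≋-refl (Λ-scaled n f) ⟩
    α b p (suc n) · 𝟎 ⊕ Λ a b n f ⊕ b · p ↑ n · Λ a b n f
      ≈⟨ solve 4 (λ x l b r → x :* con 0ℤ :+ l :+ b :* r :* l := (con 1ℤ :- (:- b) :* r) :* l)
          ≋-refl _ _ b (p ↑ n) ⟩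
    (𝟏 ⊕ − (− b · p ↑ n)) · Λ a b n f ∎
    where open ≋-Reasoning

  A : Series → Series
  A c = ∑ (λ k → α c p k · f k)

  A-summable : ∀ {c} → Small c → ∀ (s : ℕ → Series) → Summable (λ k → α c p k · s k)
  A-summable sc s k = ·-vanishˡ (s k) (α-summable sc sp k)

  α-scale : ∀ c k → α (c · p) p k ≋ p ↑ k · α c p k
  α-scale c zero = solve 0 (con 1ℤ := con 1ℤ :* con 1ℤ) ≋-refl
  α-scale c (suc k) = ≋-trans (·-cong ≋-refl (α-scale c k))
    (solve 4 (λ c p r x → c :* p :* r :* (r :* x) := p :* r :* (c :* r :* x)) ≋-refl c p (p ↑ k) (α c p k))

  A-step : ∀ {c} → Small c → A c ≋ (𝟏 ⊕ c) · A (c · p)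
  A-step {c} sc = begin
    A c
      ≈⟨ ∑-cong (λ k → ≋-trans (·-cong ≋-refl (f-split k))
          (≋-trans (solve 4 (λ x s r y → x :* (s :+ r :* y) := x :* s :+ r :* x :* y)
              ≋-refl (α c p k) (shift f k) (p ↑ k) (f k))
            (⊕-cong ≋-refl (·-cong (≋-sym (α-scale c k)) ≋-refl)))) ⟩
    ∑ (λ k → α c p k · shift f k ⊕ α (c · p) p k · f k)
      ≈⟨ ∑-⊕ _ _ ⟩
    ∑ (λ k → α c p k · shift f k) ⊕ A (c · p)
      ≈⟨ ⊕-cong (∑-head (A-summable sc (shift f))) ≋-refl ⟩
    𝟏 · 𝟎 ⊕ ∑ (λ k → c · p ↑ k · α c p k · f k) ⊕ A (c · p)
      ≈⟨ ⊕-cong (⊕-cong ≋-refl (≋-trans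
          (∑-cong λ k → ≋-trans
            (solve 4 (λ c r x y → c :* r :* x :* y := c :* (r :* x :* y)) ≋-refl c (p ↑ k) (α c p k) (f k))
            (·-cong ≋-refl (·-cong (≋-sym (α-scale c k)) ≋-refl)))
          (≋-sym (∑-· c (A-summable (·-small p sc) f))))) ≋-refl ⟩
    𝟏 · 𝟎 ⊕ c · A (c · p) ⊕ A (c · p)
      ≈⟨ solve 2 (λ c x → con 1ℤ :* con 0ℤ :+ c :* x :+ x := (con 1ℤ :+ c) :* x) ≋-refl c _ ⟩
    (𝟏 ⊕ c) · A (c · p) ∎
    where open ≋-Reasoning

  A-≈ : ∀ {c c′ k} → c ≈[ k ] c′ → A c ≈[ k ] A c′
  A-≈ e = ∑-≈ λ j → ≈-· (α-≈ j e ≈-refl) ≈-refl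

  A-𝟎 : A 𝟎 ≋ E p p
  A-𝟎 = ≋-trans (∑-head (A-summable ≈-refl f)) (≋-trans
    (⊕-cong (·-cong ≋-refl (E-cong (·𝟏 p) ≋-refl))
      (≈⇒≋ λ k → ∑-vanish λ j → ≋⇒≈ (solve 3 (λ x y z → con 0ℤ :* x :* y :* z := con 0ℤ)
        ≋-refl (p ↑ j) (α 𝟎 p j) (f (suc j)))))
    (solve 1 (λ x → con 1ℤ :* x :+ con 0ℤ := x) ≋-refl (E p p)))

  -- Euler's expansion of (-c;p)_∞ as Σ cᵏ p^{k(k-1)/2} / (p;p)ₖ, multiplied by (p;p)_∞. It is
  -- solved by iterating c ↦ c p down to c = 0.
  A-product : ∀ {c} → Small c → A c ≋ E (− c) p · E p p
  A-product {c} sc = ≋-trans (≈⇒≋ λ k → A-≈ (≋⇒≈ (≋-sym (·𝟏 c))))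
    (≋-trans (E-limit sp (λ n → A (c · p ↑ n)) step (λ n → A-≈ (·↑-vanish c sp n)))
      (·-cong ≋-refl A-𝟎))
    where
    step : ∀ n → A (c · p ↑ n) ≋ (𝟏 ⊕ − (− c · p ↑ n)) · A (c · p ↑ suc n)
    step n = ≋-trans (A-step (·-small (p ↑ n) sc)) (·-cong
      (solve 2 (λ c r → con 1ℤ :+ c :* r := con 1ℤ :- (:- c) :* r) ≋-refl c (p ↑ n))
      (≈⇒≋ λ k → A-≈ (≋⇒≈ (solve 3 (λ c r p → c :* r :* p := c :* (p :* r)) ≋-refl c (p ↑ n) p))))

  -- The sums `Λ a b n f` join Euler's series `A a` at n = 0 to the bilateral sum in the limit;
  -- passing from n to n + 1 contributes the factor 1 + b pⁿ.
  θ-product : θ a b ≋ E (− b) p · (E (− a) p · E p p)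
  θ-product = ≋-trans (E-colimit sp (λ n → Λ a b n f) Λ-step (Λ-limit f-≈𝟏))
    (·-cong ≋-refl (A-product sa))

E-≈poch-tail : ∀ a {p} → Small p → ∀ n → E a p ≋ poch a p n · E (a · p ↑ n) p
E-≈poch-tail a sp zero = ≋-trans (E-cong (≋-sym (·𝟏 a)) ≋-refl)
  (solve 1 (λ x → x := con 1ℤ :* x) ≋-refl _)
E-≈poch-tail a sp (suc n) = ≋-trans (E-≈poch-tail a sp n)
  (≋-trans (·-cong ≋-refl (E-head↑ a sp n))
    (solve 3 (λ x y z → x :* (y :* z) := x :* y :* z) ≋-refl _ _ _))

-- The bilateral series at a variable base point.

-- In closed form p^{n(n-1)/2} (u + p)(u + p²)...(u + pⁿ). At p = q² and u = q it is the numerator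
-- q^{n²} (-q;q²)ₙ of `v₀-term` (`N-q`), and it makes sense at u = 0.
N : Series → Series → ℕ → Series
N p u zero = 𝟏
N p u (suc n) = N p u n · (p ↑ n · (u ⊕ p ↑ suc n))

-- The product in `N` with its factors moved one step down: (u + 1)(u + p)...(u + p^{n-1}). It
-- mediates between `N` at u p (`N-scale`) and `N` at u (`K-N`).
K : Series → Series → ℕ → Series
K p u zero = 𝟏
K p u (suc n) = K p u n · (p ↑ n · (u ⊕ p ↑ n))

N-scale : ∀ p u n → N p (u · p) n ≋ p ↑ n · K p u n
N-scale p u zero = solve 0 (con 1ℤ := con 1ℤ :* con 1ℤ) ≋-refl
N-scale p u (suc n) = ≋-trans (·-cong (N-scale p u n) ≋-refl)
  (solve 4 (λ p u r k → r :* k :* (r :* (u :* p :+ p :* r)) := p :* r :* (k :* (r :* (u :+ r))))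
    ≋-refl p u (p ↑ n) (K p u n))

K-N : ∀ p u n → K p u n · (u ⊕ p ↑ n) ≋ (𝟏 ⊕ u) · N p u n
K-N p u zero = solve 1 (λ u → con 1ℤ :* (u :+ con 1ℤ) := (con 1ℤ :+ u) :* con 1ℤ) ≋-refl u
K-N p u (suc n) = ≋-trans
  (solve 4 (λ p u r k → k :* (r :* (u :+ r)) :* (u :+ p :* r) := k :* (u :+ r) :* (r :* (u :+ p :* r)))
    ≋-refl p u (p ↑ n) (K p u n))
  (≋-trans (·-cong (K-N p u n) ≋-refl)
    (solve 3 (λ u x y → (con 1ℤ :+ u) :* x :* y := (con 1ℤ :+ u) :* (x :* y)) ≋-refl u _ _))

N-≈ : ∀ {p p′ u u′ k} n → p ≈[ k ] p′ → u ≈[ k ] u′ → N p u n ≈[ k ] N p′ u′ n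
N-≈ zero e e′ = ≈-refl
N-≈ (suc n) e e′ = ≈-· (N-≈ n e e′) (≈-· (↑-≈ n e) (≈-⊕ e′ (↑-≈ (suc n) e)))

-- The n-th term of the bilateral series in the variable u is
-- U p u n / (u;p)_∞ for n ≥ 0, and the term of index - n is the n-th term in
-- the variable - u.
U : Series → Series → ℕ → Series
U p u n = N p u n · E (u · p ↑ n) p

S : Series → Series → Series
S p u = ∑ (U p u)

S-≈ : ∀ {p p′ u u′ k} → p ≈[ k ] p′ → u ≈[ k ] u′ → S p u ≈[ k ] S p′ u′
S-≈ e e′ = ∑-≈ λ n → ≈-· (N-≈ n e e′) (E-≈ (≈-· e′ (↑-≈ n e)) e)

S-cong : ∀ {p p′ u u′} → p ≋ p′ → u ≋ u′ → S p u ≋ S p′ u′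
S-cong e e′ = ≈⇒≋ λ k → S-≈ (≋⇒≈ e) (≋⇒≈ e′)

N-summable : ∀ {p u} → Small p → Small u → Summable (N p u)
N-summable sp su zero = vanish-0
N-summable sp su (suc n) = ·-vanishʳ _ (≈-weaken (ℕ.≤-reflexive (ℕ.+-comm 1 n))
  (·-vanish (↑-vanish sp n) (⊕-vanish su (≈-weaken (s≤s z≤n) (↑-vanish sp (suc n))))))

U-summable : ∀ {p u} → Small p → Small u → Summable (U p u)
U-summable sp su n = ·-vanishˡ _ (N-summable sp su n)

-- (1 + u) U_n(u) - (1 + u²) U_n(up) telescopes.
S-step : ∀ {p u} → Small p → Small u →
  (𝟏 ⊕ u) · S p u ≋ (𝟏 ⊕ u · u) · S p (u · p) ⊕ u · E u p
S-step {p} {u} sp su = begin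
  (𝟏 ⊕ u) · S p u
    ≈⟨ ∑-· (𝟏 ⊕ u) (U-summable sp su) ⟩
  ∑ (λ n → (𝟏 ⊕ u) · U p u n)
    ≈⟨ ∑-cong term ⟩
  ∑ (λ n → (𝟏 ⊕ u · u) · U p (u · p) n ⊕ (M n ⊕ − M (suc n)))
    ≈⟨ ∑-⊕ _ _ ⟩
  ∑ (λ n → (𝟏 ⊕ u · u) · U p (u · p) n) ⊕ ∑ (λ n → M n ⊕ − M (suc n))
    ≈⟨ ⊕-cong (≋-sym (∑-· (𝟏 ⊕ u · u) (U-summable sp (·-small p su))))
        (≋-trans (∑-telescope M-summable)
          (·-cong ≋-refl (≋-trans (·-cong ≋-refl (E-cong (·𝟏 u) ≋-refl))
            (solve 1 (λ x → con 1ℤ :* x := x) ≋-refl _)))) ⟩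
  (𝟏 ⊕ u · u) · S p (u · p) ⊕ u · E u p ∎
  where
  open ≋-Reasoning
  M : ℕ → Series
  M n = u · (K p u n · E (u · p ↑ n) p)
  M-summable : Summable M
  M-summable zero = vanish-0
  M-summable (suc n) = ·-vanish su (·-vanishˡ _ (·-vanishʳ _ (·-vanishˡ _ (↑-vanish sp n))))
  term : ∀ n → (𝟏 ⊕ u) · U p u n ≋ (𝟏 ⊕ u · u) · U p (u · p) n ⊕ (M n ⊕ − M (suc n))
  term n = begin
    (𝟏 ⊕ u) · (N p u n · E (u · r) p)
      ≈⟨ ·-cong ≋-refl (·-cong ≋-refl (E-head↑ u sp n)) ⟩
    (𝟏 ⊕ u) · (N p u n · ((𝟏 ⊕ − (u · r)) · e))
      ≈⟨ solve 3 (λ x y z → x :* (y :* z) := x :* y :* z) ≋-refl _ _ _ ⟩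
    (𝟏 ⊕ u) · N p u n · ((𝟏 ⊕ − (u · r)) · e)
      ≈⟨ ·-cong (≋-sym (K-N p u n)) ≋-refl ⟩
    K p u n · (u ⊕ r) · ((𝟏 ⊕ − (u · r)) · e)
      -- With r = pⁿ this rests on (u + r)(1 - ur) = (1 + u²) r + u (1 - ur) - u r (u + r); the last
      -- two summands become `M n` and `M (suc n)`.
      ≈⟨ solve 4 (λ u r k e → k :* (u :+ r) :* ((con 1ℤ :- u :* r) :* e) :=
          (con 1ℤ :+ u :* u) :* (r :* k :* e) :+
          (u :* (k :* ((con 1ℤ :- u :* r) :* e)) :- u :* (k :* (r :* (u :+ r)) :* e)))
          ≋-refl u r (K p u n) e ⟩
    (𝟏 ⊕ u · u) · (r · K p u n · e) ⊕
      (u · (K p u n · ((𝟏 ⊕ − (u · r)) · e)) ⊕ − M (suc n))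
      ≈⟨ ⊕-cong (·-cong ≋-refl (·-cong (N-scale p u n) (E-cong
            (solve 3 (λ u p r → u :* p :* r := u :* (p :* r)) ≋-refl u p r) ≋-refl)))
          (⊕-cong (·-cong ≋-refl (·-cong ≋-refl (E-head↑ u sp n))) ≋-refl) ⟨
    (𝟏 ⊕ u · u) · U p (u · p) n ⊕ (M n ⊕ − M (suc n)) ∎
    where
    r = p ↑ n
    e = E (u · p ↑ suc n) p

-- The bilateral series in u multiplied by (u;p)_∞ (-u;p)_∞. The subtracted product is the term of
-- index 0, which both halves contain.
G : Series → Series → Series
G p u = E (− u) p · S p u ⊕ E u p · S p (− u) ⊕ − (E u p · E (− u) p)

G-≈ : ∀ {p u u′ k} → u ≈[ k ] u′ → G p u ≈[ k ] G p u′
G-≈ e = ≈-⊕ (≈-⊕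
  (≈-· (E-≈ (≈-− e) ≈-refl) (S-≈ ≈-refl e)) (≈-· (E-≈ e ≈-refl) (S-≈ ≈-refl (≈-− e))))
  (≈-− (≈-· (E-≈ e ≈-refl) (E-≈ (≈-− e) ≈-refl)))

G-cong : ∀ {p u u′} → u ≋ u′ → G p u ≋ G p u′
G-cong e = ≈⇒≋ λ k → G-≈ (≋⇒≈ e)

-- The boundary terms of `S-step` at u and at -u add up to -2u² e e′. This turns the coefficient -(1
-- - u²) of the doubly counted term into -(1 + u²), so the equation is homogeneous although the one
-- for `S` is not.
G-step : ∀ {p u} → Small p → Small u → G p u ≋ (𝟏 ⊕ u · u) · G p (u · p)
G-step {p} {u} sp su = begin
  E (− u) p · S p u ⊕ E u p · S p (− u) ⊕ − (E u p · E (− u) p)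
    ≈⟨ ⊕-cong (⊕-cong (·-cong e′-head ≋-refl) (·-cong e-head ≋-refl)) (−-cong (·-cong e-head e′-head)) ⟩
  (𝟏 ⊕ u) · e′ · s ⊕ (𝟏 ⊕ − u) · e · s′ ⊕ − ((𝟏 ⊕ − u) · e · ((𝟏 ⊕ u) · e′))
    ≈⟨ solve 5 (λ u e e′ s s′ →
        (con 1ℤ :+ u) :* e′ :* s :+ (con 1ℤ :- u) :* e :* s′ :-
          (con 1ℤ :- u) :* e :* ((con 1ℤ :+ u) :* e′) :=
        e′ :* ((con 1ℤ :+ u) :* s) :+ e :* ((con 1ℤ :- u) :* s′) :-
          (con 1ℤ :- u) :* e :* ((con 1ℤ :+ u) :* e′))
        ≋-refl u e e′ s s′ ⟩
  e′ · ((𝟏 ⊕ u) · s) ⊕ e · ((𝟏 ⊕ − u) · s′) ⊕ − ((𝟏 ⊕ − u) · e · ((𝟏 ⊕ u) · e′))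
    ≈⟨ ⊕-cong (⊕-cong (·-cong ≋-refl (≋-trans (S-step sp su) (⊕-cong ≋-refl (·-cong ≋-refl e-head))))
          (·-cong ≋-refl (≋-trans (S-step sp (−-vanish su))
            (⊕-cong (·-cong ≋-refl (S-cong ≋-refl neg-scale)) (·-cong ≋-refl e′-head))))) ≋-refl ⟩
  e′ · ((𝟏 ⊕ u · u) · t ⊕ u · ((𝟏 ⊕ − u) · e)) ⊕
    e · ((𝟏 ⊕ − u · − u) · t′ ⊕ − u · ((𝟏 ⊕ u) · e′)) ⊕ − ((𝟏 ⊕ − u) · e · ((𝟏 ⊕ u) · e′))
    ≈⟨ solve 5 (λ u e e′ t t′ →
        e′ :* ((con 1ℤ :+ u :* u) :* t :+ u :* ((con 1ℤ :- u) :* e)) :+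
        e :* ((con 1ℤ :+ (:- u) :* (:- u)) :* t′ :+ (:- u) :* ((con 1ℤ :+ u) :* e′)) :-
        (con 1ℤ :- u) :* e :* ((con 1ℤ :+ u) :* e′) :=
        (con 1ℤ :+ u :* u) :* (e′ :* t :+ e :* t′ :- e :* e′)) ≋-refl u e e′ t t′ ⟩
  (𝟏 ⊕ u · u) · G p (u · p) ∎
  where
  open ≋-Reasoning
  e = E (u · p) p
  e′ = E (− (u · p)) p
  s = S p u
  s′ = S p (− u)
  t = S p (u · p)
  t′ = S p (− (u · p))
  neg-scale : − u · p ≋ − (u · p)
  neg-scale = solve 2 (λ u p → (:- u) :* p := :- (u :* p)) ≋-refl u p
  e-head : E u p ≋ (𝟏 ⊕ − u) · e
  e-head = E-head u sp
  e′-head : E (− u) p ≋ (𝟏 ⊕ u) · e′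
  e′-head = ≋-trans (E-head (− u) sp) (·-cong
    (solve 1 (λ u → con 1ℤ :- (:- u) := con 1ℤ :+ u) ≋-refl u) (E-cong neg-scale ≋-refl))

-- At u = 0 the products E are 1 and `N` is p^{n²}, so that G is 2 Σ_{n ≥ 0} p^{n²} - 1.
G-𝟎 : ∀ {p} → Small p → G p 𝟎 ≋ θ p p
G-𝟎 {p} sp = begin
  G p 𝟎
    ≈⟨ ⊕-cong (⊕-cong (·-cong e′ ≋-refl) (·-cong e (S-cong ≋-refl neg-𝟎))) (−-cong (·-cong e e′)) ⟩
  𝟏 · S p 𝟎 ⊕ 𝟏 · S p 𝟎 ⊕ − (𝟏 · 𝟏)
    ≈⟨ ⊕-cong (⊕-cong (·-cong ≋-refl S-α) (·-cong ≋-refl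
          (≋-trans S-α (∑-head (α-summable sp (·-small p sp)))))) ≋-refl ⟩
  𝟏 · ∑ (α p (p · p)) ⊕ 𝟏 · (𝟏 ⊕ ∑ (α p (p · p) ∘ suc)) ⊕ − (𝟏 · 𝟏)
    ≈⟨ solve 2 (λ x y → con 1ℤ :* x :+ con 1ℤ :* (con 1ℤ :+ y) :- con 1ℤ :* con 1ℤ := x :+ y)
        ≋-refl _ _ ⟩
  ∑ (α p (p · p)) ⊕ ∑ (α p (p · p) ∘ suc)
    ≈⟨ ∑-⊕ _ _ ⟨
  θ p p ∎
  where
  open ≋-Reasoning
  neg-𝟎 : − 𝟎 ≋ 𝟎
  neg-𝟎 = solve 0 (:- con 0ℤ := con 0ℤ) ≋-refl
  e : E 𝟎 p ≋ 𝟏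
  e = E-𝟎 sp
  e′ : E (− 𝟎) p ≋ 𝟏
  e′ = ≋-trans (E-cong neg-𝟎 ≋-refl) e
  N-α : ∀ n → N p 𝟎 n ≋ α p (p · p) n
  N-α zero = ≋-refl
  N-α (suc n) = begin
    N p 𝟎 n · (p ↑ n · (𝟎 ⊕ p · p ↑ n))
      ≈⟨ solve 3 (λ x r p → x :* (r :* (con 0ℤ :+ p :* r)) := p :* (r :* r) :* x) ≋-refl _ (p ↑ n) p ⟩
    p · (p ↑ n · p ↑ n) · N p 𝟎 n
      ≈⟨ ·-cong (·-cong ≋-refl (≋-sym (square-↑ p n))) (N-α n) ⟩
    p · (p · p) ↑ n · α p (p · p) n ∎
  S-α : S p 𝟎 ≋ ∑ (α p (p · p))
  S-α = ∑-cong λ n → ≋-trans (·-cong (N-α n) (≋-trans (E-cong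
      (solve 1 (λ r → con 0ℤ :* r := con 0ℤ) ≋-refl (p ↑ n)) ≋-refl) e)) (·𝟏 _)

G-product : ∀ {p u} → Small p → Small u → G p u ≋ E (− (u · u)) (p · p) · θ p p
G-product {p} {u} sp su = ≋-trans (G-cong (≋-sym (·𝟏 u)))
  (≋-trans (E-limit (·-small p sp) (λ n → G p (u · p ↑ n)) step (λ n → G-≈ (·↑-vanish u sp n)))
    (·-cong ≋-refl (G-𝟎 sp)))
  where
  open ≋-Reasoning
  step : ∀ n → G p (u · p ↑ n) ≋ (𝟏 ⊕ − (− (u · u) · (p · p) ↑ n)) · G p (u · p ↑ suc n)
  step n = begin
    G p (u · p ↑ n)
      ≈⟨ G-step sp (·-small _ su) ⟩
    (𝟏 ⊕ u · p ↑ n · (u · p ↑ n)) · G p (u · p ↑ n · p)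
      ≈⟨ ·-cong (solve 2 (λ u r → con 1ℤ :+ u :* r :* (u :* r) := con 1ℤ :- (:- (u :* u)) :* (r :* r))
            ≋-refl u (p ↑ n))
          (G-cong (solve 3 (λ u r p → u :* r :* p := u :* (p :* r)) ≋-refl u (p ↑ n) p)) ⟩
    (𝟏 ⊕ − (− (u · u) · (p ↑ n · p ↑ n))) · G p (u · p ↑ suc n)
      ≈⟨ ·-cong (⊕-cong ≋-refl (−-cong (·-cong ≋-refl (≋-sym (square-↑ p n))))) ≋-refl ⟩
    (𝟏 ⊕ − (− (u · u) · (p · p) ↑ n)) · G p (u · p ↑ suc n) ∎

-- Specialisation to u = q: the generating function of `v₀`.

opaque
  unfolding _·_

  ^≡↑ : ∀ f n → f ^ n ≡ f ↑ n
  ^≡↑ f zero = refl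
  ^≡↑ f (suc n) = cong (f ⊛_) (^≡↑ f n)

  ⟨⟩≡poch : ∀ a b n → ⟨ a ⨾ b ⟩ n ≡ poch a b n
  ⟨⟩≡poch a b zero = refl
  ⟨⟩≡poch a b (suc n) = cong₂ _⊛_ (⟨⟩≡poch a b n) (cong (λ r → 𝟙 ⊝ a ⊛ r) (^≡↑ b n))

  ⊛-congruent : ∀ {f f′ g g′} → f ≋ f′ → g ≋ g′ → f ⊛ g ≋ f′ · g′
  ⊛-congruent = ·-cong

  ·-inverse : ∀ f → f 0 ≡ 1ℤ → f · inv f ≋ 𝟏
  ·-inverse f f0 = pointwise (⊛-inv f f0)

  q-small : Small q
  q-small .below zero _ = refl
  q-small .below (suc m) (s≤s ())

≡⇒≋ : ∀ {f g} → f ≡ g → f ≋ g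
≡⇒≋ refl = ≋-refl

x : Series
x = q · q

x-small : Small x
x-small = ·-small q q-small

q^2 : q ^ 2 ≋ x
q^2 = ≋-trans (≡⇒≋ (^≡↑ q 2)) (solve 1 (λ q → q :* (q :* con 1ℤ) := q :* q) ≋-refl q)

N-q : ∀ n → q ↑ (n * n) · poch (− q) x n ≋ N x q n
N-q zero = solve 0 (con 1ℤ :* con 1ℤ := con 1ℤ) ≋-refl
N-q (suc n) = begin
  q ↑ (suc n * suc n) · (poch (− q) x n · (𝟏 ⊕ − (− q · r)))
    ≈⟨ ·-cong (≋-trans (≡⇒≋ (cong (q ↑_) (exponent n))) (≋-trans (^-homo-* q (n * n) _)
        (·-cong ≋-refl (·-cong ≋-refl (≋-trans (^-homo-* q n n) (≋-sym (square-↑ q n))))))) ≋-refl ⟩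
  q ↑ (n * n) · (q · r) · (poch (− q) x n · (𝟏 ⊕ − (− q · r)))
    ≈⟨ solve 4 (λ s q r y → s :* (q :* r) :* (y :* (con 1ℤ :- (:- q) :* r)) :=
        s :* y :* (r :* (q :+ q :* q :* r))) ≋-refl _ q r _ ⟩
  q ↑ (n * n) · poch (− q) x n · (r · (q ⊕ q · q · r))
    ≈⟨ ·-cong (N-q n) ≋-refl ⟩
  N x q (suc n) ∎
  where
  open ≋-Reasoning
  r = x ↑ n
  exponent : ∀ n → suc n * suc n ≡ n * n + suc (n + n)
  exponent = ℕ-solve-∀

-- The denominator cancels because (q;q²)_∞ = (q;q²)ₙ (q^{2n+1};q²)_∞.
E-v₀-term : ∀ n → E q x · v₀-term n ≋ U x q n
E-v₀-term n = begin
  E q x · v₀-term n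
    ≈⟨ ·-cong (≋-trans (E-≈poch-tail q x-small n) (·-cong (≋-sym denominator) ≋-refl)) term ⟩
  d · e · (q ↑ (n * n) · poch (− q) x n · inv d)
    ≈⟨ solve 4 (λ d e y i → d :* e :* (y :* i) := y :* e :* (d :* i)) ≋-refl d e _ (inv d) ⟩
  q ↑ (n * n) · poch (− q) x n · e · (d · inv d)
    ≈⟨ ·-cong (·-cong (N-q n) ≋-refl) (·-inverse d (poch-const n)) ⟩
  U x q n · 𝟏
    ≈⟨ ·𝟏 _ ⟩
  U x q n ∎
  where
  open ≋-Reasoning
  d = ⟨ q ⨾ q ^ 2 ⟩ n
  e = E (q · x ↑ n) x
  denominator : d ≋ poch q x n
  denominator = ≋-trans (≡⇒≋ (⟨⟩≡poch q (q ^ 2) n)) (≈⇒≋ λ k → poch-≈ n ≈-refl (≋⇒≈ q^2))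
  numerator : ⟨ ⊖ q ⨾ q ^ 2 ⟩ n ≋ poch (− q) x n
  numerator = ≋-trans (≡⇒≋ (trans (⟨⟩≡poch (⊖ q) (q ^ 2) n) (cong (λ a → poch a (q ^ 2) n) (sym (−≡⊖ q)))))
    (≈⇒≋ λ k → poch-≈ n ≈-refl (≋⇒≈ q^2))
  term : v₀-term n ≋ q ↑ (n * n) · poch (− q) x n · inv d
  term = ⊛-congruent (≋-trans (⊛-congruent (≡⇒≋ (^≡↑ q (n * n))) numerator) ≋-refl) ≋-refl

v : Series
v = ∑ v₀-term

v≡v₀ : v ≡ v₀
v≡v₀ = ∑≡Σ∞ v₀-term

E-v : E q x · v ≋ S x q
E-v = ≋-trans (∑-· (E q x) (λ n → upto λ m → v₀-vanish n m)) (∑-cong E-v₀-term)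
  where
  v₀-vanish : ∀ n m → m < n → v₀-term n m ≡ 𝟎 m
  v₀-vanish n m m<n = trans (v₀-term-vanishes n m<n) (sym (𝟎-at m))

-- The substitution q ↦ -q and the bilateral series `B`.

sign : ℕ → ℤ
sign zero = 1ℤ
sign (suc n) = ℤ.- sign n

-- The substitution of − q for q.
opaque
  σ : Series → Series
  σ f n = sign n ℤ.* f n

opaque
  unfolding σ _·_

  σ-at : ∀ f n → σ f n ≡ sign n ℤ.* f n
  σ-at f n = refl

  σ-≈ : ∀ {f g k} → f ≈[ k ] g → σ f ≈[ k ] σ g
  σ-≈ e .below m m<k = cong (sign m ℤ.*_) (below e m m<k)

  σ-𝟎 : σ 𝟎 ≋ 𝟎
  σ-𝟎 .at n = ℤ.*-zeroʳ (sign n)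

  σ-𝟏 : σ 𝟏 ≋ 𝟏
  σ-𝟏 .at zero = refl
  σ-𝟏 .at (suc n) = ℤ.*-zeroʳ (sign (suc n))

  σ-q : σ q ≋ − q
  σ-q .at 0 = refl
  σ-q .at 1 = refl
  σ-q .at (suc (suc n)) = ℤ.*-zeroʳ (sign (suc (suc n)))

  σ-⊕ : ∀ f g → σ (f ⊕ g) ≋ σ f ⊕ σ g
  σ-⊕ f g .at n = ℤ.*-distribˡ-+ (sign n) (f n) (g n)

  σ-− : ∀ f → σ (− f) ≋ − σ f
  σ-− f .at n = sym (ℤ.neg-distribʳ-* (sign n) (f n))

  σ-· : ∀ f g → σ (f · g) ≋ σ f · σ g
  σ-· f g .at n = proof f g n
    where
    open ≡-Reasoning
    rearrange : ∀ s a b c → ℤ.- s ℤ.* (a ℤ.* b ℤ.+ c) ≡ (1ℤ ℤ.* a) ℤ.* (ℤ.- s ℤ.* b) ℤ.+ ℤ.- (s ℤ.* c)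
    rearrange = solve-∀
    neg-tail : ∀ f g n → (− σ (tail f) · σ g) n ≡ (tail (σ f) · σ g) n
    neg-tail f g n = ·-cong-upto {g = σ g} {g′ = σ g} n (λ i _ → ℤ.neg-distribˡ-* (sign i) (f (suc i))) (λ _ _ → refl)
    proof : ∀ f g n → σ (f · g) n ≡ (σ f · σ g) n
    proof f g zero = trans (ℤ.*-identityˡ _) (trans (·-zero f g)
      (sym (trans (·-zero (σ f) (σ g)) (cong₂ ℤ._*_ (ℤ.*-identityˡ (f 0)) (ℤ.*-identityˡ (g 0))))))
    proof f g (suc n) = begin
      ℤ.- sign n ℤ.* (f 0 ℤ.* g (suc n) ℤ.+ (tail f · g) n)
        ≡⟨ rearrange (sign n) (f 0) (g (suc n)) ((tail f · g) n) ⟩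
      σ f 0 ℤ.* σ g (suc n) ℤ.+ ℤ.- (σ (tail f · g) n)
        ≡⟨ cong (λ c → σ f 0 ℤ.* σ g (suc n) ℤ.+ ℤ.- c) (proof (tail f) g n) ⟩
      σ f 0 ℤ.* σ g (suc n) ℤ.+ (− (σ (tail f) · σ g)) n
        ≡⟨ cong (ℤ._+_ (σ f 0 ℤ.* σ g (suc n))) (trans
            (at (solve 2 (λ a b → :- (a :* b) := (:- a) :* b) ≋-refl (σ (tail f)) (σ g)) n)
            (neg-tail f g n)) ⟩
      σ f 0 ℤ.* σ g (suc n) ℤ.+ (tail (σ f) · σ g) n ∎

σ-cong : ∀ {f g} → f ≋ g → σ f ≋ σ g
σ-cong e = ≈⇒≋ λ k → σ-≈ (≋⇒≈ e)

σ-↑ : ∀ f n → σ (f ↑ n) ≋ σ f ↑ n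
σ-↑ f zero = σ-𝟏
σ-↑ f (suc n) = ≋-trans (σ-· f _) (·-cong ≋-refl (σ-↑ f n))

σ-poch : ∀ a p n → σ (poch a p n) ≋ poch (σ a) (σ p) n
σ-poch a p zero = σ-𝟏
σ-poch a p (suc n) = ≋-trans (σ-· _ _) (·-cong (σ-poch a p n) (≋-trans (σ-⊕ _ _)
  (⊕-cong σ-𝟏 (≋-trans (σ-− _) (−-cong (≋-trans (σ-· _ _) (·-cong ≋-refl (σ-↑ p n))))))))

σ-small : ∀ {p} → Small p → Small (σ p)
σ-small sp = ≈-trans (σ-≈ sp) (≋⇒≈ σ-𝟎)

σ-E : ∀ a {p} → Small p → σ (E a p) ≋ E (σ a) (σ p)
σ-E a {p} sp = ≈⇒≋ λ k → ≈-trans (σ-≈ (E-≈poch a sp k))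
  (≈-trans (≋⇒≈ (σ-poch a p k)) (≈-sym (E-≈poch (σ a) (σ-small sp) k)))

σ-psum : ∀ n F → σ (psum n F) ≋ psum n (σ ∘ F)
σ-psum zero F = σ-𝟎
σ-psum (suc n) F = ≋-trans (σ-⊕ _ _) (⊕-cong ≋-refl (σ-psum n (F ∘ suc)))

σ-∑ : ∀ {F} → Summable F → σ (∑ F) ≋ ∑ (σ ∘ F)
σ-∑ {F} v = ≈⇒≋ λ k → ≈-trans (σ-≈ (∑-≈psum v k)) (≈-trans (≋⇒≈ (σ-psum k F))
  (≈-sym (∑-≈psum (λ n → ≈-trans (σ-≈ (v n)) (≋⇒≈ σ-𝟎)) k)))

σ-N : ∀ p u n → σ (N p u n) ≋ N (σ p) (σ u) n
σ-N p u zero = σ-𝟏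
σ-N p u (suc n) = ≋-trans (σ-· _ _) (·-cong (σ-N p u n) (≋-trans (σ-· _ _)
  (·-cong (σ-↑ p n) (≋-trans (σ-⊕ _ _) (⊕-cong ≋-refl (σ-↑ p (suc n)))))))

σ-S : ∀ {p u} → Small p → Small u → σ (S p u) ≋ S (σ p) (σ u)
σ-S {p} {u} sp su = ≋-trans (σ-∑ (U-summable sp su)) (∑-cong λ n → ≋-trans (σ-· _ _)
  (·-cong (σ-N p u n) (≋-trans (σ-E _ sp) (E-cong (≋-trans (σ-· _ _) (·-cong ≋-refl (σ-↑ p n))) ≋-refl))))

σ-x : σ x ≋ x
σ-x = ≋-trans (σ-· q q) (≋-trans (·-cong σ-q σ-q)
  (solve 1 (λ q → (:- q) :* (:- q) := q :* q) ≋-refl q))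

E-σv : E (− q) x · σ v ≋ S x (− q)
E-σv = begin
  E (− q) x · σ v    ≈⟨ ·-cong (≋-trans (σ-E q x-small) (E-cong σ-q σ-x)) ≋-refl ⟨
  σ (E q x) · σ v    ≈⟨ σ-· _ _ ⟨
  σ (E q x · v)      ≈⟨ σ-cong E-v ⟩
  σ (S x q)          ≈⟨ σ-S x-small q-small ⟩
  S (σ x) (σ q)      ≈⟨ S-cong σ-x σ-q ⟩
  S x (− q)          ∎
  where open ≋-Reasoning

-- The bilateral series Σ_{n ∈ ℤ} q^{n²} (-q;q²)_n / (q;q²)_n.
B : Series
B = v ⊕ σ v ⊕ − 𝟏

-- This is `G-product` at p = q², u = q; the two denominators combine to (q;q²)_∞ (-q;q²)_∞ =
-- (q²;q⁴)_∞.
B-product : E x (x · x) · B ≋ E (− x) (x · x) · θ x x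
B-product = begin
  E x (x · x) · (v ⊕ σ v ⊕ − 𝟏)
    ≈⟨ ·-cong (≋-sym (E-conjugate q x-small)) ≋-refl ⟩
  E q x · E (− q) x · (v ⊕ σ v ⊕ − 𝟏)
    ≈⟨ solve 4 (λ e e′ v s → e :* e′ :* (v :+ s :- con 1ℤ) :=
        e′ :* (e :* v) :+ e :* (e′ :* s) :- e :* e′) ≋-refl _ _ _ _ ⟩
  E (− q) x · (E q x · v) ⊕ E q x · (E (− q) x · σ v) ⊕ − (E q x · E (− q) x)
    ≈⟨ ⊕-cong (⊕-cong (·-cong ≋-refl E-v) (·-cong ≋-refl E-σv)) ≋-refl ⟩
  G x q
    ≈⟨ G-product x-small q-small ⟩
  E (− x) (x · x) · θ x x ∎
  where open ≋-Reasoning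

-- Product formulas and dissections of theta functions.

sq : Series → Series
sq f = f · f

-- In `Ψ` the indices n and -1-n give equal terms, so it is twice Ramanujan's ψ; hence the factors 2
-- below.
φ Ψ O⁺ O⁻ J P : Series → Series
φ z  = θ z z
Ψ z  = θ z 𝟏
O⁺ z = E (− z) (sq z)
O⁻ z = E z (sq z)
J z  = E z z
P z  = E (− z) z

φ-cong : ∀ {z z′} → z ≋ z′ → φ z ≋ φ z′
φ-cong e = θ-cong e e

Ψ-cong : ∀ {z z′} → z ≋ z′ → Ψ z ≋ Ψ z′
Ψ-cong e = θ-cong e ≋-refl

−− : ∀ f → − (− f) ≋ f
−− = solve 1 (λ f → :- (:- f) := f) ≋-refl

cancel-𝟏 : ∀ {f g} → f ≈[ 1 ] 𝟏 → f · g ≋ f → g ≋ 𝟏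
cancel-𝟏 {f} {g} f₀ e = begin
  g                  ≈⟨ solve 1 (λ g → g := con 1ℤ :* g) ≋-refl g ⟩
  𝟏 · g              ≈⟨ ·-cong inverse ≋-refl ⟨
  f · inv f · g      ≈⟨ solve 3 (λ f i g → f :* i :* g := i :* (f :* g)) ≋-refl f (inv f) g ⟩
  inv f · (f · g)    ≈⟨ ·-cong ≋-refl e ⟩
  inv f · f          ≈⟨ solve 2 (λ f i → i :* f := f :* i) ≋-refl f (inv f) ⟩
  f · inv f          ≈⟨ inverse ⟩
  𝟏                  ∎
  where
  open ≋-Reasoning
  inverse : f · inv f ≋ 𝟏
  inverse = ·-inverse f (trans (below f₀ 0 (s≤s z≤n)) (cong (λ h → h 0) 𝟏≡𝟙))

module _ {z : Series} (sz : Small z) where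

  private
    szz : Small (sq z)
    szz = ·-small z sz

  O⁻-J : O⁻ z · J (sq z) ≋ J z
  O⁻-J = ≋-sym (E-double z sz)

  J-P : J z · P z ≋ J (sq z)
  J-P = E-conjugate z sz

  O⁻-O⁺ : O⁻ z · O⁺ z ≋ O⁻ (sq z)
  O⁻-O⁺ = E-conjugate z szz

  O⁺-P : O⁺ z · P (sq z) ≋ P z
  O⁺-P = ≋-sym (≋-trans (E-double (− z) sz) (·-cong ≋-refl (E-cong
    (solve 1 (λ z → (:- z) :* z := :- (z :* z)) ≋-refl z) ≋-refl)))

  -- Euler's identity between partitions into odd parts and into distinct parts. J(z²) O⁻ P = J(z) P
  -- = J(z²), and J(z²) cancels since its constant term is 1.
  O⁻-P : O⁻ z · P z ≋ 𝟏
  O⁻-P = cancel-𝟏 (E-≈𝟏 szz szz) (begin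
    J (sq z) · (O⁻ z · P z)  ≈⟨ solve 3 (λ a b c → a :* (b :* c) := b :* a :* c) ≋-refl _ _ _ ⟩
    O⁻ z · J (sq z) · P z    ≈⟨ ·-cong O⁻-J ≋-refl ⟩
    J z · P z                ≈⟨ J-P ⟩
    J (sq z)                 ∎)
    where open ≋-Reasoning

  φ-product : φ z ≋ O⁺ z · (O⁺ z · J (sq z))
  φ-product = TripleProduct.θ-product z sz

  φ-neg-product : φ (− z) ≋ O⁻ z · J z
  φ-neg-product = ≋-trans (TripleProduct.θ-product (− z) (−-vanish sz)) (≋-trans
    (·-cong (E-cong (−− z) square) (·-cong (E-cong (−− z) square) (E-cong square square)))
    (·-cong ≋-refl O⁻-J))
    where
    square : − z · − z ≋ sq z
    square = solve 1 (λ z → (:- z) :* (:- z) := z :* z) ≋-refl z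

  Ψ-product : Ψ z ≋ κ (+ 2) · (P z · J (sq z))
  Ψ-product = begin
    Ψ z
      ≈⟨ TripleProduct.θ-product 𝟏 sz ⟩
    E (− 𝟏) (z · 𝟏) · (E (− z) (z · 𝟏) · E (z · 𝟏) (z · 𝟏))
      ≈⟨ ·-cong (≋-trans (E-cong ≋-refl (·𝟏 z)) (≋-trans (E-head (− 𝟏) sz)
            (·-cong ≋-refl (E-cong (solve 1 (λ z → (:- con 1ℤ) :* z := :- z) ≋-refl z) ≋-refl))))
          (·-cong (E-cong ≋-refl (·𝟏 z)) (E-cong (·𝟏 z) (·𝟏 z))) ⟩
    (𝟏 ⊕ − (− 𝟏)) · P z · (P z · J z)
      ≈⟨ solve 2 (λ p j → (con 1ℤ :- (:- con 1ℤ)) :* p :* (p :* j) := con (+ 2) :* (p :* (j :* p)))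
          ≋-refl _ _ ⟩
    κ (+ 2) · (P z · (J z · P z))
      ≈⟨ ·-cong ≋-refl (·-cong ≋-refl J-P) ⟩
    κ (+ 2) · (P z · J (sq z)) ∎
    where open ≋-Reasoning

module _ {z : Series} (sz : Small z) where

  private
    szz : Small (sq z)
    szz = ·-small z sz

  -- O⁻(z) O⁺(z) = O⁻(z²) makes the product a perfect square. This is the relation that carries the
  -- denominator of B from φ(-y) to φ(-w).
  φ-φ-neg : φ z · φ (− z) ≋ sq (φ (− sq z))
  φ-φ-neg = begin
    φ z · φ (− z)
      ≈⟨ ·-cong (φ-product sz) (≋-trans (φ-neg-product sz) (·-cong ≋-refl (≋-sym (O⁻-J sz)))) ⟩
    O⁺ z · (O⁺ z · J (sq z)) · (O⁻ z · (O⁻ z · J (sq z)))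
      ≈⟨ solve 3 (λ o j n → o :* (o :* j) :* (n :* (n :* j)) := (n :* o :* j) :* (n :* o :* j)) ≋-refl _ _ _ ⟩
    sq (O⁻ z · O⁺ z · J (sq z))
      ≈⟨ ·-cong factor factor ⟨
    sq (φ (− sq z)) ∎
    where
    open ≋-Reasoning
    factor : φ (− sq z) ≋ O⁻ z · O⁺ z · J (sq z)
    factor = ≋-trans (φ-neg-product szz) (·-cong (≋-sym (O⁻-O⁺ sz)) ≋-refl)

  Ψ² : sq (Ψ z) ≋ κ (+ 2) · (φ z · Ψ (sq z))
  Ψ² = begin
    sq (Ψ z)
      ≈⟨ ·-cong factor factor ⟩
    sq (κ (+ 2) · (O⁺ z · P (sq z) · J (sq z)))
      ≈⟨ solve 3 (λ o p j → con (+ 2) :* (o :* p :* j) :* (con (+ 2) :* (o :* p :* j)) :=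
          con (+ 2) :* (o :* (o :* j) :* (con (+ 2) :* (p :* (j :* p))))) ≋-refl _ _ _ ⟩
    κ (+ 2) · (O⁺ z · (O⁺ z · J (sq z)) · (κ (+ 2) · (P (sq z) · (J (sq z) · P (sq z)))))
      ≈⟨ ·-cong ≋-refl (·-cong (φ-product sz) (≋-trans (Ψ-product szz)
          (·-cong ≋-refl (·-cong ≋-refl (≋-sym (J-P szz)))))) ⟨
    κ (+ 2) · (φ z · Ψ (sq z)) ∎
    where
    open ≋-Reasoning
    factor : Ψ z ≋ κ (+ 2) · (O⁺ z · P (sq z) · J (sq z))
    factor = ≋-trans (Ψ-product sz) (·-cong ≋-refl (·-cong (≋-sym (O⁺-P sz)) ≋-refl))

-- The terms of even index of φ z give φ (z⁴), those of odd index z Ψ (z⁸).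
φ-split : ∀ {z} → Small z → φ z ≋ φ (sq (sq z)) ⊕ z · Ψ (sq (sq (sq z)))
φ-split {z} sz = begin
  φ z
    ≈⟨ ∑-pairs (θ-summable z sz) ⟩
  ∑ (λ k → (c (k * 2) ⊕ c (suc (k * 2))) ⊕ (c (suc (k * 2)) ⊕ c (suc k * 2)))
    ≈⟨ (∑-cong λ k → ≋-trans
        (solve 3 (λ a b d → (a :+ b) :+ (b :+ d) := (a :+ d) :+ (b :+ b)) ≋-refl _ _ _)
        (⊕-cong (⊕-cong (c-even k) (c-even (suc k)))
          (≋-trans (⊕-cong (c-odd k) (≋-trans (c-odd k) (·-cong ≋-refl (α-𝟏 k))))
            (solve 3 (λ z a b → z :* a :+ z :* b := z :* (a :+ b)) ≋-refl z _ _)))) ⟩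
  ∑ (λ k → θ-term z4 z4 k ⊕ z · θ-term z8 𝟏 k)
    ≈⟨ ∑-⊕ _ _ ⟩
  φ z4 ⊕ ∑ (λ k → z · θ-term z8 𝟏 k)
    ≈⟨ ⊕-cong ≋-refl (≋-sym (∑-· z (θ-summable 𝟏 (·-small z4 (·-small (sq z) (·-small z sz)))))) ⟩
  φ z4 ⊕ z · Ψ z8 ∎
  where
  open ≋-Reasoning
  z4 z8 : Series
  z4 = sq (sq z)
  z8 = sq z4
  c : ℕ → Series
  c = α z (sq z)
  ↑-even : ∀ k → sq z ↑ (k * 2) ≋ z4 ↑ k
  ↑-even zero = ≋-refl
  ↑-even (suc k) = ≋-trans (·-cong ≋-refl (·-cong ≋-refl (↑-even k)))
    (solve 2 (λ s r → s :* (s :* r) := s :* s :* r) ≋-refl (sq z) (z4 ↑ k))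
  c-even : ∀ k → c (k * 2) ≋ α z4 z8 k
  c-even zero = ≋-refl
  c-even (suc k) = ≋-trans
    (·-cong (·-cong ≋-refl (·-cong ≋-refl (↑-even k)))
      (·-cong (·-cong ≋-refl (↑-even k)) (c-even k)))
    (≋-trans (solve 3 (λ z r y → z :* (z :* z :* r) :* (z :* r :* y) := z :* z :* (z :* z) :* (r :* r) :* y)
        ≋-refl z (z4 ↑ k) _)
      (·-cong (·-cong ≋-refl (≋-sym (square-↑ z4 k))) ≋-refl))
  α-z8 : ∀ k → z4 ↑ k · α z4 z8 k ≋ α z8 (z8 · 𝟏) k
  α-z8 zero = ·𝟏 𝟏
  α-z8 (suc k) = ≋-trans
    (solve 4 (λ s r t y → s :* r :* (s :* t :* y) := s :* s :* t :* (r :* y)) ≋-refl z4 (z4 ↑ k) (z8 ↑ k) _)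
    (·-cong (·-cong ≋-refl (↑-cong k (≋-sym (·𝟏 z8)))) (α-z8 k))
  α-𝟏 : ∀ k → α z8 (z8 · 𝟏) k ≋ α 𝟏 (z8 · 𝟏) (suc k)
  α-𝟏 zero = solve 0 (con 1ℤ := con 1ℤ :* con 1ℤ :* con 1ℤ) ≋-refl
  α-𝟏 (suc k) = ≋-trans (·-cong ≋-refl (α-𝟏 k))
    (·-cong (solve 2 (λ s t → s :* t := con 1ℤ :* (s :* con 1ℤ :* t)) ≋-refl z8 ((z8 · 𝟏) ↑ k)) ≋-refl)
  c-odd : ∀ k → c (suc (k * 2)) ≋ z · α z8 (z8 · 𝟏) k
  c-odd k = ≋-trans (·-cong (·-cong ≋-refl (↑-even k)) (c-even k))
    (≋-trans (solve 3 (λ z r y → z :* r :* y := z :* (r :* y)) ≋-refl z (z4 ↑ k) _)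
      (·-cong ≋-refl (α-z8 k)))

φ-neg-split : ∀ {z} → Small z → φ (− z) ≋ φ (sq (sq z)) ⊕ − (z · Ψ (sq (sq (sq z))))
φ-neg-split {z} sz = ≋-trans (φ-split (−-vanish sz)) (⊕-cong
  (φ-cong (·-cong square square))
  (≋-trans (·-cong ≋-refl (Ψ-cong (·-cong (·-cong square square) (·-cong square square))))
    (solve 2 (λ z y → (:- z) :* y := :- (z :* y)) ≋-refl z _)))
  where
  square : sq (− z) ≋ sq z
  square = solve 1 (λ z → (:- z) :* (:- z) := z :* z) ≋-refl z

module _ {z : Series} (sz : Small z) where

  private
    t = sq z
    t2 = sq t
    t4 = sq t2
    t8 = sq t4
    st : Small t
    st = ·-small z sz

  -- The square root z of t serves to write φ(-t)² as φ(z) φ(-z), which `φ-split` exhibits as a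
  -- difference of squares.
  φ-neg² : sq (φ (− t)) ≋ sq (φ t2) ⊕ − (t · sq (Ψ t4))
  φ-neg² = ≋-trans (≋-sym (φ-φ-neg sz)) (≋-trans (·-cong (φ-split sz) (φ-neg-split sz))
    (solve 3 (λ z a b → (a :+ z :* b) :* (a :- z :* b) := a :* a :- z :* z :* (b :* b)) ≋-refl z _ _))

  -- By `φ-split`, φ(t)² and φ(-t)² differ by 4t φ(t⁴) Ψ(t⁸) = 2t Ψ(t⁴)², which flips the sign in
  -- `φ-neg²`.
  φ² : sq (φ t) ≋ sq (φ t2) ⊕ t · sq (Ψ t4)
  φ² = begin
    sq (φ t)
      ≈⟨ ·-cong (φ-split st) (φ-split st) ⟩
    sq (φ t4 ⊕ t · Ψ t8)
      ≈⟨ solve 3 (λ t c d → (c :+ t :* d) :* (c :+ t :* d) :=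
          (c :- t :* d) :* (c :- t :* d) :+ con (+ 2) :* (t :* (con (+ 2) :* (c :* d)))) ≋-refl t _ _ ⟩
    sq (φ t4 ⊕ − (t · Ψ t8)) ⊕ κ (+ 2) · (t · (κ (+ 2) · (φ t4 · Ψ t8)))
      ≈⟨ ⊕-cong (·-cong (φ-neg-split st) (φ-neg-split st))
          (·-cong ≋-refl (·-cong ≋-refl (Ψ² (·-small t2 (·-small t st))))) ⟨
    sq (φ (− t)) ⊕ κ (+ 2) · (t · sq (Ψ t4))
      ≈⟨ ⊕-cong φ-neg² ≋-refl ⟩
    sq (φ t2) ⊕ − (t · sq (Ψ t4)) ⊕ κ (+ 2) · (t · sq (Ψ t4))
      ≈⟨ solve 2 (λ a b → a :- b :+ con (+ 2) :* b := a :+ b) ≋-refl _ _ ⟩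
    sq (φ t2) ⊕ t · sq (Ψ t4) ∎
    where open ≋-Reasoning

  -- Jacobi's identity between fourth powers of theta functions: the squares of `φ²` and `φ-neg²`
  -- differ by t (2 φ(t²) Ψ(t⁴))², and `Ψ²` evaluates the bracket.
  φ⁴ : sq (sq (φ t)) ≋ sq (sq (φ (− t))) ⊕ t · sq (sq (Ψ t2))
  φ⁴ = begin
    sq (sq (φ t))
      ≈⟨ ·-cong φ² φ² ⟩
    sq (sq (φ t2) ⊕ t · sq (Ψ t4))
      ≈⟨ solve 3 (λ t a b → (a :* a :+ t :* (b :* b)) :* (a :* a :+ t :* (b :* b)) :=
          (a :* a :- t :* (b :* b)) :* (a :* a :- t :* (b :* b)) :+
          t :* ((con (+ 2) :* (a :* b)) :* (con (+ 2) :* (a :* b)))) ≋-refl t _ _ ⟩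
    sq (sq (φ t2) ⊕ − (t · sq (Ψ t4))) ⊕ t · sq (κ (+ 2) · (φ t2 · Ψ t4))
      ≈⟨ ⊕-cong (·-cong φ-neg² φ-neg²) (·-cong ≋-refl (·-cong factor factor)) ⟨
    sq (sq (φ (− t))) ⊕ t · sq (sq (Ψ t2)) ∎
    where
    open ≋-Reasoning
    factor = Ψ² (·-small t st)

-- Sorting the factors of J(z) by index modulo 3 gives a triple product with base z³ = (-z)(-z²).
pentagonal : ∀ {z} → Small z → J z ≋ θ (− z) (− sq z)
pentagonal {z} sz = begin
  J z
    ≈⟨ E-triple z sz ⟩
  E z z3 · E (z · z) z3 · E (z · sq z) z3
    ≈⟨ solve 3 (λ a b c → a :* b :* c := b :* (a :* c)) ≋-refl _ _ _ ⟩
  E (z · z) z3 · (E z z3 · E (z · sq z) z3)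
    ≈⟨ ·-cong (E-cong (≋-sym (−− _)) cube) (·-cong (E-cong (≋-sym (−− z)) cube)
        (E-cong (≋-trans (solve 1 (λ z → z :* (z :* z) := z :* z :* z) ≋-refl z) cube) cube)) ⟩
  _
    ≈⟨ TripleProduct.θ-product (− sq z) (−-vanish sz) ⟨
  θ (− z) (− sq z) ∎
  where
  open ≋-Reasoning
  z3 = z · z · z
  cube : z3 ≋ − z · − sq z
  cube = solve 1 (λ z → z :* z :* z := (:- z) :* (:- (z :* z))) ≋-refl z

-- Through Ψ(z) = 2 J(z²)² / J(z) and φ(-z) = J(z)² / J(z²) the exponents are 2·9 - 17 = 1 and 2·17
-- - 9 = 25. To avoid division, the 17 factors O⁻ are split: nine cancel against P (`O⁻-P`), eight
-- turn J(z²) into J(z) (`O⁻-J`).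
Ψ⁹φ¹⁷ : ∀ {z} → Small z →
  Ψ z ↑ 9 · φ (− z) ↑ 17 ≋ κ (+ 2) ↑ 9 · (J (sq z) · J z ↑ 25)
Ψ⁹φ¹⁷ {z} sz = begin
  Ψ z ↑ 9 · φ (− z) ↑ 17
    ≈⟨ ·-cong (↑-cong 9 (Ψ-product sz)) (↑-cong 17 (φ-neg-product sz)) ⟩
  (κ (+ 2) · (P z · J (sq z))) ↑ 9 · (O⁻ z · J z) ↑ 17
    ≈⟨ ·-cong (≋-trans (^-distrib-* _ _ 9) (·-cong ≋-refl (^-distrib-* _ _ 9)))
        (≋-trans (^-distrib-* _ _ 17) (·-cong (^-homo-* (O⁻ z) 9 8) ≋-refl)) ⟩
  κ (+ 2) ↑ 9 · (P z ↑ 9 · (J (sq z) · J (sq z) ↑ 8)) · (O⁻ z ↑ 9 · O⁻ z ↑ 8 · J z ↑ 17)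
    ≈⟨ solve 7 (λ t p j j8 o9 o8 i → t :* (p :* (j :* j8)) :* (o9 :* o8 :* i) :=
        t :* (j :* (o9 :* p :* (o8 :* j8 :* i)))) ≋-refl
        (κ (+ 2) ↑ 9) (P z ↑ 9) (J (sq z)) (J (sq z) ↑ 8) (O⁻ z ↑ 9) (O⁻ z ↑ 8) (J z ↑ 17) ⟩
  κ (+ 2) ↑ 9 · (J (sq z) · (O⁻ z ↑ 9 · P z ↑ 9 · (O⁻ z ↑ 8 · J (sq z) ↑ 8 · J z ↑ 17)))
    ≈⟨ ·-cong ≋-refl (·-cong ≋-refl (·-cong
        (≋-trans (≋-sym (^-distrib-* _ _ 9)) (↑-cong 9 (O⁻-P sz)))
        (·-cong (≋-trans (≋-sym (^-distrib-* _ _ 8)) (↑-cong 8 (O⁻-J sz))) ≋-refl))) ⟩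
  κ (+ 2) ↑ 9 · (J (sq z) · (𝟏 ↑ 9 · (J z ↑ 8 · J z ↑ 17)))
    ≈⟨ ·-cong ≋-refl (·-cong ≋-refl (≋-trans
        (·-cong (solve 0 (con 1ℤ :^ 9 := con 1ℤ) ≋-refl) (≋-sym (^-homo-* (J z) 8 17)))
        (solve 1 (λ a → con 1ℤ :* a := a) ≋-refl _))) ⟩
  κ (+ 2) ↑ 9 · (J (sq z) · J z ↑ 25) ∎
  where
  open ≋-Reasoning

B-φ : B · φ (− sq x) ≋ sq (φ x)
B-φ = begin
  B · φ (− sq x)
    ≈⟨ ·-cong ≋-refl (≋-trans (φ-neg-product (·-small x x-small))
        (·-cong (≋-sym (O⁻-O⁺ x-small)) ≋-refl)) ⟩
  B · (O⁻ x · O⁺ x · J (sq x))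
    ≈⟨ solve 4 (λ b o p j → b :* (o :* p :* j) := o :* b :* (p :* j)) ≋-refl _ _ _ _ ⟩
  O⁻ x · B · (O⁺ x · J (sq x))
    ≈⟨ ·-cong B-product ≋-refl ⟩
  O⁺ x · φ x · (O⁺ x · J (sq x))
    ≈⟨ solve 3 (λ o f j → o :* f :* (o :* j) := o :* (o :* j) :* f) ≋-refl _ _ _ ⟩
  O⁺ x · (O⁺ x · J (sq x)) · φ x
    ≈⟨ ·-cong (φ-product x-small) ≋-refl ⟨
  sq (φ x) ∎
  where open ≋-Reasoning

-- Supports of series modulo an integer.

-- For c = 0 the support is exact, as 0 divides only 0; for c = 25 it is the support modulo 25. The
-- disjunction lets both cases share all lemmas without a decision procedure for `P`.
record Supp (c : ℤ) (P : ℕ → Set) (f : Series) : Set where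
  constructor supp
  field on : ∀ n → c ∣ f n ⊎ P n
open Supp

∣0 : ∀ c → c ∣ 0ℤ
∣0 c = divides 0ℤ (sym (ℤ.*-zeroˡ c))

≡-∣ : ∀ {c a b} → a ≡ b → c ∣ a → c ∣ b
≡-∣ refl d = d

Supp-≋ : ∀ {c P f g} → f ≋ g → Supp c P f → Supp c P g
Supp-≋ e s .on n with on s n
... | inj₁ d = inj₁ (≡-∣ (at e n) d)
... | inj₂ p = inj₂ p

Supp-weaken : ∀ {c P Q f} → (∀ n → P n → Q n) → Supp c P f → Supp c Q f
Supp-weaken w s .on n = map₂ (w n) (on s n)

Supp-exact : ∀ {c P f} → Supp 0ℤ P f → Supp c P f
Supp-exact {c} s .on n with on s n
... | inj₁ d = inj₁ (∣-trans (∣0 c) d)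
... | inj₂ p = inj₂ p

Supp-× : ∀ {c P Q f} → Supp c P f → Supp c Q f → Supp c (λ n → P n × Q n) f
Supp-× s s′ .on n with on s n | on s′ n
... | inj₁ d | _      = inj₁ d
... | inj₂ _ | inj₁ d = inj₁ d
... | inj₂ p | inj₂ p′ = inj₂ (p , p′)

∣-+-⊎ : ∀ {c a b} {X : Set} → c ∣ a ⊎ X → c ∣ b ⊎ X → c ∣ a ℤ.+ b ⊎ X
∣-+-⊎ (inj₁ d) (inj₁ d′) = inj₁ (∣m∣n⇒∣m+n d d′)
∣-+-⊎ (inj₁ _) (inj₂ p)  = inj₂ p
∣-+-⊎ (inj₂ p) _         = inj₂ p

-- `X` does not depend on the summand, so one summand that yields it settles the sum. For X = ⊥ this
-- is plain divisibility of a convolution.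
·-divides : ∀ {c} {X : Set} n f g → (∀ i j → i + j ≡ n → c ∣ f i ℤ.* g j ⊎ X) → c ∣ (f · g) n ⊎ X
·-divides zero f g d with d 0 0 refl
... | inj₁ e = inj₁ (≡-∣ (sym (·-zero f g)) e)
... | inj₂ p = inj₂ p
·-divides (suc n) f g d
  with ∣-+-⊎ (d 0 (suc n) refl) (·-divides n (tail f) g (λ i j e → d (suc i) j (cong suc e)))
... | inj₁ e = inj₁ (≡-∣ (sym (·-suc f g n)) e)
... | inj₂ p = inj₂ p

Supp-· : ∀ {c P Q R f g} → (∀ i j → P i → Q j → R (i + j)) →
  Supp c P f → Supp c Q g → Supp c R (f · g)
Supp-· {c} {P} {Q} {R} {f} {g} add s s′ .on n = ·-divides n f g term
  where
  term : ∀ i j → i + j ≡ n → c ∣ f i ℤ.* g j ⊎ R n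
  term i j refl with on s i | on s′ j
  ... | inj₁ d | _      = inj₁ (∣m⇒∣m*n (g j) d)
  ... | inj₂ _ | inj₁ d = inj₁ (∣n⇒∣m*n (f i) d)
  ... | inj₂ p | inj₂ r = inj₂ (add i j p r)

Supp-⊕ : ∀ {c P f g} → Supp c P f → Supp c P g → Supp c P (f ⊕ g)
Supp-⊕ {f = f} {g} s s′ .on n with ∣-+-⊎ (on s n) (on s′ n)
... | inj₁ d = inj₁ (≡-∣ (sym (⊕-at f g n)) d)
... | inj₂ p = inj₂ p

Supp-− : ∀ {c P f} → Supp c P f → Supp c P (− f)
Supp-− {f = f} s .on n with on s n
... | inj₁ d = inj₁ (≡-∣ (sym (−-at f n)) (∣m⇒∣-m d))
... | inj₂ p = inj₂ p

Supp-𝟎 : ∀ {c P} → Supp c P 𝟎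
Supp-𝟎 {c} .on n = inj₁ (≡-∣ (sym (𝟎-at n)) (∣0 c))

Supp-∑ : ∀ {c P} F → (∀ n → Supp c P (F n)) → Supp c P (∑ F)
Supp-∑ {c} {P} F s .on m with on (Supp-psum (suc m) F s) m
  where
  Supp-psum : ∀ N F → (∀ n → Supp c P (F n)) → Supp c P (psum N F)
  Supp-psum zero F s = Supp-𝟎
  Supp-psum (suc N) F s = Supp-⊕ (s 0) (Supp-psum N (F ∘ suc) (s ∘ suc))
... | inj₁ d = inj₁ (≡-∣ (sym (∑-coefficient F m)) d)
... | inj₂ p = inj₂ p

opaque
  unfolding _·_ scale

  κ-·-at : ∀ c f n → (κ c · f) n ≡ c ℤ.* f n
  κ-·-at c f n = trans (at (·-cong (κ≋scale c) (≋-refl {f})) n)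
    (trans (·-scaleˡ c 𝟏 f n) (cong (c ℤ.*_) (·-identityˡ f n)))

  Supp-κ : ∀ {c P} k → P 0 → Supp c P (κ k)
  Supp-κ k p .on zero = inj₂ p
  Supp-κ {c} k p .on (suc n) =
    inj₁ (≡-∣ (sym (trans (at (κ≋scale k) (suc n)) (ℤ.*-zeroʳ k))) (∣0 c))

  Supp-q : ∀ {c} → Supp c (_≡ 1) q
  Supp-q {c} .on 0 = inj₁ (∣0 c)
  Supp-q .on 1 = inj₂ refl
  Supp-q {c} .on (suc (suc n)) = inj₁ (∣0 c)

  q-·-suc : ∀ f n → (q · f) (suc n) ≡ f n
  q-·-suc f n = trans (cong₂ ℤ._+_ (ℤ.*-zeroˡ (f (suc n)))
    (·-cong-upto {tail q} {𝟏} {f} {f} n (λ { zero _ → refl ; (suc i) _ → refl }) (λ _ _ → refl)))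
    (trans (ℤ.+-identityˡ _) (·-identityˡ f n))

  head-tail : ∀ f → f ≋ κ (f 0) ⊕ q · tail f
  head-tail f .at zero = sym (trans (cong₂ ℤ._+_
    (trans (at (κ≋scale (f 0)) 0) (ℤ.*-identityʳ (f 0)))
    (trans (·-zero q (tail f)) (ℤ.*-zeroˡ (f 1)))) (ℤ.+-identityʳ (f 0)))
  head-tail f .at (suc n) = sym (trans (cong₂ ℤ._+_
    (trans (at (κ≋scale (f 0)) (suc n)) (ℤ.*-zeroʳ (f 0))) (q-·-suc (tail f) n))
    (ℤ.+-identityˡ (f (suc n))))

Supp-multiple : ∀ {c P} f → Supp c P (κ c · f)
Supp-multiple {c} f .on n = inj₁ (≡-∣ (sym (κ-·-at c f n)) (divides (f n) (ℤ.*-comm c (f n))))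

-- `P` is a submonoid of ℕ, so the series supported on it form a subring. It is applied to the
-- multiples of d and, for constants, to the exponent 0 alone.
module Subring {c : ℤ} {P : ℕ → Set} (P-0 : P 0) (P-+ : ∀ i j → P i → P j → P (i + j)) where

  S-𝟏 : Supp c P 𝟏
  S-𝟏 = Supp-κ 1ℤ P-0

  S-· : ∀ {f g} → Supp c P f → Supp c P g → Supp c P (f · g)
  S-· = Supp-· P-+

  S-↑ : ∀ {f} n → Supp c P f → Supp c P (f ↑ n)
  S-↑ zero s = S-𝟏
  S-↑ (suc n) s = S-· s (S-↑ n s)

  S-α : ∀ {a p} j → Supp c P a → Supp c P p → Supp c P (α a p j)
  S-α zero s s′ = S-𝟏
  S-α (suc j) s s′ = S-· (S-· s (S-↑ j s′)) (S-α j s s′)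

  S-θ : ∀ {a b} → Supp c P a → Supp c P b → Supp c P (θ a b)
  S-θ s s′ = Supp-∑ _ λ n → Supp-⊕ (S-α n s (S-· s s′)) (S-α (suc n) s′ (S-· s s′))

-- Residue classes of exponents; fifth and 25th powers.

Class : (d : ℕ) .{{_ : ℕ.NonZero d}} → ℕ → ℕ → Set
Class d r n = n % d ≡ r

Class-+ : ∀ {d} .{{_ : ℕ.NonZero d}} {r s} i j → Class d r i → Class d s j → Class d ((r + s) % d) (i + j)
Class-+ {d} i j e e′ = trans (%-distribˡ-+ i j d) (cong₂ (λ r s → (r + s) % d) e e′)

0-% : ∀ d .{{_ : ℕ.NonZero d}} → 0 % d ≡ 0
0-% (suc d) = refl

module Multiples {c : ℤ} (d : ℕ) .{{_ : ℕ.NonZero d}} =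
  Subring {c} {Class d 0} (0-% d) (λ i j e e′ → trans (Class-+ {d} i j e e′) (0-% d))

-- Frobenius: expand f = f(0) + q · tail f.
fifth-power : ∀ f → Supp (+ 5) (Class 5 0) (f ↑ 5)
fifth-power f .on n = proof n f
  where
  open Multiples {+ 5} 5
  expand : ∀ f → let c = κ (f 0) ; s = q · tail f in
    f ↑ 5 ≋ c ↑ 5 ⊕
      κ (+ 5) · (c ↑ 4 · s ⊕ κ (+ 2) · (c ↑ 3 · s ↑ 2) ⊕ κ (+ 2) · (c ↑ 2 · s ↑ 3) ⊕ c · s ↑ 4) ⊕
      q · (q · (q · (q · (q · tail f ↑ 5))))
  expand f = ≋-trans (↑-cong 5 (head-tail f)) (solve 3 (λ c q t →
    (c :+ q :* t) :^ 5 := c :^ 5 :+ con (+ 5) :* (c :^ 4 :* (q :* t) :+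
      con (+ 2) :* (c :^ 3 :* (q :* t) :^ 2) :+ con (+ 2) :* (c :^ 2 :* (q :* t) :^ 3) :+
      c :* (q :* t) :^ 4) :+ q :* (q :* (q :* (q :* (q :* t :^ 5))))) ≋-refl (κ (f 0)) q (tail f))
  q-·-zero : ∀ g → (q · g) 0 ≡ 0ℤ
  q-·-zero g = trans (·-zero q g) (ℤ.*-zeroˡ (g 0))
  last-term : ∀ n g → (∀ m → n ≡ 5 + m → + 5 ∣ g m ⊎ Class 5 0 m) →
    + 5 ∣ (q · (q · (q · (q · (q · g))))) n ⊎ Class 5 0 n
  last-term 0 g h = inj₂ refl
  last-term 1 g h = inj₁ (≡-∣ (sym (trans (q-·-suc _ 0) (q-·-zero _))) (∣0 (+ 5)))
  last-term 2 g h = inj₁ (≡-∣ (sym (trans (q-·-suc _ 1) (trans (q-·-suc _ 0) (q-·-zero _)))) (∣0 (+ 5)))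
  last-term 3 g h = inj₁ (≡-∣ (sym (trans (q-·-suc _ 2) (trans (q-·-suc _ 1)
    (trans (q-·-suc _ 0) (q-·-zero _))))) (∣0 (+ 5)))
  last-term 4 g h = inj₁ (≡-∣ (sym (trans (q-·-suc _ 3) (trans (q-·-suc _ 2) (trans (q-·-suc _ 1)
    (trans (q-·-suc _ 0) (q-·-zero g)))))) (∣0 (+ 5)))
  last-term (suc (suc (suc (suc (suc m))))) g h with h m refl
  ... | inj₁ d = inj₁ (≡-∣ (sym (trans (q-·-suc _ (4 + m)) (trans (q-·-suc _ (3 + m))
    (trans (q-·-suc _ (2 + m)) (trans (q-·-suc _ (1 + m)) (q-·-suc g m)))))) d)
  ... | inj₂ e = inj₂ (trans (Class-+ {5} {0} {0} 5 m refl e) refl)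
  proof : ∀ n f → + 5 ∣ (f ↑ 5) n ⊎ Class 5 0 n
  proof n f = transfer (∣-+-⊎
    (on (Supp-⊕ (S-↑ 5 (Supp-κ (f 0) refl)) (Supp-multiple _)) n)
    (last-term n (tail f ↑ 5) λ { m refl → proof m (tail f) }))
    where
    transfer : _ → + 5 ∣ (f ↑ 5) n ⊎ Class 5 0 n
    transfer (inj₁ d) = inj₁ (≡-∣ (trans (sym (⊕-at _ _ n)) (sym (at (expand f) n))) d)
    transfer (inj₂ p) = inj₂ p

split-support : ∀ {c P f} → Supp c P f → ∃[ g ] ∃[ h ] (f ≋ g ⊕ κ c · h) × Supp 0ℤ P g
split-support {c} {P} {f} s = g , h , pointwise decomposition , supp g-support
  where
  g h : Series
  g n with on s n
  ... | inj₁ _ = 0ℤ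
  ... | inj₂ _ = f n
  h n with on s n
  ... | inj₁ (divides k _) = k
  ... | inj₂ _ = 0ℤ
  g-support : ∀ n → 0ℤ ∣ g n ⊎ P n
  g-support n with on s n
  ... | inj₁ _ = inj₁ (∣0 0ℤ)
  ... | inj₂ p = inj₂ p
  pieces : ∀ n → f n ≡ g n ℤ.+ c ℤ.* h n
  pieces n with on s n
  ... | inj₁ (divides k e) = trans e (trans (ℤ.*-comm k c) (sym (ℤ.+-identityˡ _)))
  ... | inj₂ _ = sym (trans (cong (ℤ._+_ (f n)) (ℤ.*-zeroʳ c)) (ℤ.+-identityʳ (f n)))
  decomposition : ∀ n → f n ≡ (g ⊕ κ c · h) n
  decomposition n = trans (pieces n)
    (sym (trans (⊕-at g _ n) (cong (ℤ._+_ (g n)) (κ-·-at c h n))))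

-- f⁵ = g + 5h with the exponents of g exactly divisible by 5, and in (g + 5h)⁵ every binomial term
-- except g⁵ is a multiple of 25.
25th-power : ∀ f → Supp (+ 25) (Class 5 0) (f ↑ 25)
25th-power f with split-support (fifth-power f)
... | g , h , e , s = Supp-≋ (≋-sym expand) (Supp-⊕ (S-↑ 5 (Supp-exact s)) (Supp-multiple _))
  where
  open Multiples {+ 25} 5
  expand : f ↑ 25 ≋ g ↑ 5 ⊕ κ (+ 25) · (g ↑ 4 · h ⊕ κ (+ 10) · (g ↑ 3 · h ↑ 2) ⊕
    κ (+ 50) · (g ↑ 2 · h ↑ 3) ⊕ κ (+ 125) · (g · h ↑ 4) ⊕ κ (+ 125) · h ↑ 5)
  expand = ≋-trans (≋-sym (^-assocʳ f 5 5)) (≋-trans (↑-cong 5 e)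
    (solve 2 (λ g h → (g :+ con (+ 5) :* h) :^ 5 := g :^ 5 :+ con (+ 25) :* (g :^ 4 :* h :+
      con (+ 10) :* (g :^ 3 :* h :^ 2) :+ con (+ 50) :* (g :^ 2 :* h :^ 3) :+
      con (+ 125) :* (g :* h :^ 4) :+ con (+ 125) :* h :^ 5)) ≋-refl g h))

-- Quadratic exponents modulo 5.

-- The exponents of y Ψ(w) are the numbers (4j + 2)². Those of y w J(w²) are numbers
-- n with 24 n = (48 j + 8)² + 800, and - 1 is a square modulo 5.
SquareMod5 : ℕ → Set
SquareMod5 n = (n % 5 ≢ 2) × (n % 5 ≢ 3)

SquareMod5? : ∀ n → Dec (SquareMod5 n)
SquareMod5? n = ¬? (n % 5 ℕ.≟ 2) ×-dec ¬? (n % 5 ℕ.≟ 3)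

SquareMod5-≡ : ∀ m n → n % 5 ≡ m % 5 → SquareMod5 m → SquareMod5 n
SquareMod5-≡ m n e (p , p′) = (λ e′ → p (trans (sym e) e′)) , (λ e′ → p′ (trans (sym e) e′))

SquareMod5-+ : ∀ i j → SquareMod5 i → Class 5 0 j → SquareMod5 (i + j)
SquareMod5-+ i j s e = SquareMod5-≡ i (i + j) (trans (%-distribˡ-+ i j 5)
  (trans (cong (λ r → (i % 5 + r) % 5) e)
    (trans (cong (_% 5) (ℕ.+-identityʳ (i % 5))) (m%n%n≡m%n i 5)))) s

-- The exponent of α a p j when a and p are powers of q.
tri : ℕ → ℕ → ℕ → ℕ
tri A C zero = 0
tri A C (suc j) = A + j * C + tri A C j

-- Five consecutive increments A + jC add up to 5 (A + (j + 2) C). Residues modulo 5 therefore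
-- repeat with period 5, and five values of j decide.
tri-periodic : ∀ s A C j → s + tri A C (5 + j) ≡ s + tri A C j + (A + (2 + j) * C) * 5
tri-periodic s A C j = lemma s A C j (tri A C j)
  where
  lemma : ∀ s A C j t →
    s + (A + (4 + j) * C + (A + (3 + j) * C + (A + (2 + j) * C +
      (A + (1 + j) * C + (A + j * C + t))))) ≡
    s + t + (A + (2 + j) * C) * 5
  lemma = ℕ-solve-∀

tri-SquareMod5 : ∀ s A C → (∀ {j} → j < 5 → SquareMod5 (s + tri A C j)) →
  ∀ j → SquareMod5 (s + tri A C j)
tri-SquareMod5 s A C base 0 = base (s≤s z≤n)
tri-SquareMod5 s A C base 1 = base (s≤s (s≤s z≤n))
tri-SquareMod5 s A C base 2 = base (s≤s (s≤s (s≤s z≤n)))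
tri-SquareMod5 s A C base 3 = base (s≤s (s≤s (s≤s (s≤s z≤n))))
tri-SquareMod5 s A C base 4 = base (s≤s (s≤s (s≤s (s≤s (s≤s z≤n)))))
tri-SquareMod5 s A C base (suc (suc (suc (suc (suc j))))) = SquareMod5-≡ (s + tri A C j) (s + tri A C (5 + j))
  (trans (cong (_% 5) (tri-periodic s A C j)) ([m+kn]%n≡m%n (s + tri A C j) (A + (2 + j) * C) 5))
  (tri-SquareMod5 s A C base j)

-- An integer multiple of qᵉ. The coefficient is left open, so signs need no care.
Monomial : ℕ → Series → Set
Monomial e = Supp 0ℤ (_≡ e)

Monomial-· : ∀ {d e f g} → Monomial d f → Monomial e g → Monomial (d + e) (f · g)
Monomial-· = Supp-· (λ i j → cong₂ ℕ._+_)

Monomial-↑ : ∀ {e f} n → Monomial e f → Monomial (n * e) (f ↑ n)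
Monomial-↑ zero m = Supp-κ 1ℤ refl
Monomial-↑ (suc n) m = Monomial-· m (Monomial-↑ n m)

Monomial-α : ∀ {d e a p} j → Monomial d a → Monomial e p → Monomial (tri d e j) (α a p j)
Monomial-α zero m m′ = Supp-κ 1ℤ refl
Monomial-α (suc j) m m′ = Monomial-· (Monomial-· m (Monomial-↑ j m′)) (Monomial-α j m m′)

Monomial-Class : ∀ {c e f} d .{{_ : ℕ.NonZero d}} → Monomial e f → Supp c (Class d (e % d)) f
Monomial-Class d m = Supp-exact (Supp-weaken (λ { n refl → refl }) m)

monomial-θ : ∀ {s A B m a b} → Monomial s m → Monomial A a → Monomial B b →
  (∀ {j} → j < 5 → SquareMod5 (s + tri A (A + B) j)) →
  (∀ {j} → j < 5 → SquareMod5 (s + tri B (A + B) j)) →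
  Supp 0ℤ SquareMod5 (m · θ a b)
monomial-θ {s} {A} {B} {m} {a} {b} ms ma mb base base′ =
  Supp-· {Q = λ n → SquareMod5 (s + n)} (λ { i j refl p → p }) ms (Supp-∑ _ λ n → Supp-⊕
    (Supp-weaken (λ { _ refl → tri-SquareMod5 s A (A + B) base n }) (Monomial-α n ma mp))
    (Supp-weaken (λ { _ refl → tri-SquareMod5 s B (A + B) base′ (suc n) }) (Monomial-α (suc n) mb mp)))
  where mp = Monomial-· ma mb

-- The dissection of B φ(-w)⁸.

y y₂ y₄ w w₂ : Series
y  = sq x
y₂ = sq y
y₄ = sq y₂
w  = sq y₄
w₂ = sq w

y-small : Small y
y-small = ·-small x x-small

y₂-small : Small y₂
y₂-small = ·-small y y-small

y₄-small : Small y₄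
y₄-small = ·-small y₂ y₂-small

w-small : Small w
w-small = ·-small y₄ y₄-small

-- The dissections are φ(y) = a + y b, φ(y₂)² = a² + y₂ b² and a² = A + y₄ C.
a b f A C : Series
a = φ y₄
b = Ψ w
f = φ (− w)
A = sq (φ w)
C = sq (Ψ w₂)

-- f² = φ(y₄) φ(-y₄), φ(-y₄)² = φ(y₂) φ(-y₂) and φ(-y₂)² = φ(y) φ(-y) reduce f⁸ to a single φ(-y),
-- which `B-φ` absorbs.
B-f : B · sq (sq (sq f)) ≋ sq (φ x) · (φ y · sq (φ y₂) · sq (sq a))
B-f = begin
  B · sq (sq (sq f))
    ≈⟨ ·-cong ≋-refl (sq-cong (sq-cong (≋-sym (φ-φ-neg y₄-small)))) ⟩
  B · sq (sq (a · φ (− y₄)))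
    ≈⟨ solve 3 (λ b a n → let m = a :* n in b :* (m :* m :* (m :* m)) :=
        b :* (a :* a :* (a :* a) :* (n :* n :* (n :* n)))) ≋-refl B a (φ (− y₄)) ⟩
  B · (sq (sq a) · sq (sq (φ (− y₄))))
    ≈⟨ ·-cong ≋-refl (·-cong ≋-refl (sq-cong (≋-sym (φ-φ-neg y₂-small)))) ⟩
  B · (sq (sq a) · sq (φ y₂ · φ (− y₂)))
    ≈⟨ solve 4 (λ b s a n → b :* (s :* (a :* n :* (a :* n))) := b :* (s :* (a :* a) :* (n :* n)))
        ≋-refl B (sq (sq a)) (φ y₂) (φ (− y₂)) ⟩
  B · (sq (sq a) · sq (φ y₂) · sq (φ (− y₂)))
    ≈⟨ ·-cong ≋-refl (·-cong ≋-refl (≋-sym (φ-φ-neg y-small))) ⟩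
  B · (sq (sq a) · sq (φ y₂) · (φ y · φ (− y)))
    ≈⟨ solve 5 (λ b s a p n → b :* (s :* a :* (p :* n)) := b :* n :* (p :* a :* s))
        ≋-refl B (sq (sq a)) (sq (φ y₂)) (φ y) (φ (− y)) ⟩
  B · φ (− y) · (φ y · sq (φ y₂) · sq (sq a))
    ≈⟨ ·-cong B-φ ≋-refl ⟩
  sq (φ x) · (φ y · sq (φ y₂) · sq (sq a)) ∎
  where
  open ≋-Reasoning
  sq-cong : ∀ {f g} → f ≋ g → sq f ≋ sq g
  sq-cong e = ·-cong e e

-- `a` is a series in q¹⁶ and `b` one in q³². Hence `even` has exponents 0 modulo 8, `y · y₂ · odd`
-- 12 modulo 16 and `y · core` 4 modulo 16.
even odd core : Series
even = a ↑ 9 ⊕ κ (+ 4) · (a ↑ 7 · b ↑ 2) · y₂ ⊕ κ (+ 3) · (a ↑ 5 · b ↑ 4) · sq y₂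
odd  = κ (+ 4) · (a ↑ 6 · b ↑ 3)
core = κ (+ 3) · (sq (sq (sq a)) · b) ⊕ y₄ · (sq (sq a) · (sq (sq b) · b))

dissection : sq (φ y) · (φ y · sq (φ y₂) · sq (sq a)) ≋ even ⊕ y · y₂ · odd ⊕ y · core
dissection = ≋-trans
  (·-cong (·-cong split split) (·-cong (·-cong split (φ² y-small)) ≋-refl))
  (solve 3 (λ y a b → let y₂ = y :* y ; y₄ = y₂ :* y₂ ; a₄ = a :* a :* (a :* a) ; s = a :+ y :* b in
    s :* s :* (s :* (a :* a :+ y₂ :* (b :* b)) :* a₄) :=
    a :^ 9 :+ con (+ 4) :* (a :^ 7 :* b :^ 2) :* y₂ :+ con (+ 3) :* (a :^ 5 :* b :^ 4) :* (y₂ :* y₂) :+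
    y :* y₂ :* (con (+ 4) :* (a :^ 6 :* b :^ 3)) :+
    y :* (con (+ 3) :* (a₄ :* a₄ :* b) :+ y₄ :* (a₄ :* (b :* b :* (b :* b) :* b)))) ≋-refl y a b)
  where
  split : φ y ≋ a ⊕ y · b
  split = φ-split y-small

H : Series
H = κ (+ 16) · (A · C · (sq A ⊕ w · sq C) · b)

b⁴ : sq (sq b) ≋ κ (+ 4) · (A · C)
b⁴ = ≋-trans (·-cong (Ψ² w-small) (Ψ² w-small))
  (solve 2 (λ p s → con (+ 2) :* (p :* s) :* (con (+ 2) :* (p :* s)) :=
    con (+ 4) :* (p :* p :* (s :* s))) ≋-refl (φ w) (Ψ w₂))

-- Expanding in A, C and y₄ puts the odd powers of y₄ into `y₄ · H`. With u = w C² and g = f⁴, `φ⁴`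
-- reads A² = g + u and reduces the even part to (3g² + 32 u A²) b; by `b⁴`, 32 u A² = 2w (4AC)² =
-- 2w b⁸.
core-dissection : core ≋ y₄ · H ⊕ (κ (+ 3) · (b · f ↑ 8) ⊕ κ (+ 2) · (w · b ↑ 9))
core-dissection = begin
  core
    ≈⟨ ⊕-cong (·-cong ≋-refl (·-cong (·-cong a⁴ a⁴) ≋-refl))
        (·-cong ≋-refl (·-cong a⁴ (·-cong b⁴ ≋-refl))) ⟩
  κ (+ 3) · (sq (sq s) · b) ⊕ y₄ · (sq s · (κ (+ 4) · (A · C) · b))
    ≈⟨ solve 4 (λ y A C b → let w = y :* y ; s = A :+ y :* C ; u = w :* (C :* C) in
        con (+ 3) :* (s :* s :* (s :* s) :* b) :+ y :* (s :* s :* (con (+ 4) :* (A :* C) :* b)) :=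
        y :* (con (+ 16) :* (A :* C :* (A :* A :+ u) :* b)) :+
        (A :* A :* (con (+ 3) :* b :* (A :* A) :+ con (+ 26) :* (u :* b)) :+ con (+ 3) :* (b :* (u :* u))))
        ≋-refl y₄ A C b ⟩
  y₄ · H ⊕ (sq A · (κ (+ 3) · b · sq A ⊕ κ (+ 26) · (u · b)) ⊕ κ (+ 3) · (b · (u · u)))
    ≈⟨ ⊕-cong ≋-refl (⊕-cong (·-cong A² (⊕-cong (·-cong ≋-refl A²) ≋-refl)) ≋-refl) ⟩
  y₄ · H ⊕ ((g ⊕ u) · (κ (+ 3) · b · (g ⊕ u) ⊕ κ (+ 26) · (u · b)) ⊕ κ (+ 3) · (b · (u · u)))
    ≈⟨ ⊕-cong ≋-refl (solve 3 (λ g u b →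
        (g :+ u) :* (con (+ 3) :* b :* (g :+ u) :+ con (+ 26) :* (u :* b)) :+ con (+ 3) :* (b :* (u :* u)) :=
        con (+ 3) :* (b :* (g :* g)) :+ con (+ 32) :* (u :* (g :+ u) :* b)) ≋-refl g u b) ⟩
  y₄ · H ⊕ (κ (+ 3) · (b · (g · g)) ⊕ κ (+ 32) · (u · (g ⊕ u) · b))
    ≈⟨ ⊕-cong ≋-refl (⊕-cong ≋-refl (·-cong ≋-refl (·-cong (·-cong ≋-refl (≋-sym A²)) ≋-refl))) ⟩
  y₄ · H ⊕ (κ (+ 3) · (b · (g · g)) ⊕ κ (+ 32) · (u · sq A · b))
    ≈⟨ ⊕-cong ≋-refl (⊕-cong
        (solve 2 (λ b f → let g = f :* f :* (f :* f) in
          con (+ 3) :* (b :* (g :* g)) := con (+ 3) :* (b :* f :^ 8)) ≋-refl b f)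
        (solve 4 (λ w A C b → con (+ 32) :* (w :* (C :* C) :* (A :* A) :* b) :=
          con (+ 2) :* (w :* (con (+ 4) :* (A :* C) :* (con (+ 4) :* (A :* C)) :* b))) ≋-refl w A C b)) ⟩
  y₄ · H ⊕ (κ (+ 3) · (b · f ↑ 8) ⊕ κ (+ 2) · (w · (κ (+ 4) · (A · C) · (κ (+ 4) · (A · C)) · b)))
    ≈⟨ ⊕-cong ≋-refl (⊕-cong ≋-refl (·-cong ≋-refl (·-cong ≋-refl (≋-trans
        (·-cong (·-cong (≋-sym b⁴) (≋-sym b⁴)) ≋-refl)
        (solve 1 (λ b → b :* b :* (b :* b) :* (b :* b :* (b :* b)) :* b := b :^ 9) ≋-refl b))))) ⟩
  y₄ · H ⊕ (κ (+ 3) · (b · f ↑ 8) ⊕ κ (+ 2) · (w · b ↑ 9)) ∎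
  where
  open ≋-Reasoning
  s = A ⊕ y₄ · C
  u = w · sq C
  g = sq (sq f)
  a⁴ : sq (sq a) ≋ sq s
  a⁴ = ·-cong (φ² y₂-small) (φ² y₂-small)
  A² : sq A ≋ g ⊕ u
  A² = φ⁴ y₄-small

D : Series
D = f ↑ 25

-- Of the 25 factors f, eight clear the denominator of B (`B-f`) and the other 17 meet b⁹ in
-- `Ψ⁹φ¹⁷`.
B-D : B · D ≋
  x · (sq (Ψ y₂) · (φ y · sq (φ y₂) · sq (sq a)) · f ↑ 17) ⊕ even · f ↑ 17 ⊕ y · y₂ · (odd · f ↑ 17) ⊕
  y · y₄ · (H · f ↑ 17) ⊕
  (κ (+ 3) · (y · b · D) ⊕ κ (+ 2) · (κ (+ 2) ↑ 9) · (y · w · J w₂ · J w ↑ 25))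
B-D = begin
  B · D
    ≈⟨ ·-cong ≋-refl (≋-trans (^-homo-* f 8 17) (·-cong
        (solve 1 (λ f → f :^ 8 := f :* f :* (f :* f) :* (f :* f :* (f :* f))) ≋-refl f) ≋-refl)) ⟩
  B · (sq (sq (sq f)) · f ↑ 17)
    ≈⟨ solve 3 (λ b f g → b :* (f :* g) := b :* f :* g) ≋-refl _ _ _ ⟩
  B · sq (sq (sq f)) · f ↑ 17
    ≈⟨ ·-cong (≋-trans B-f (·-cong (φ² q-small) ≋-refl)) ≋-refl ⟩
  (sq (φ y) ⊕ x · sq (Ψ y₂)) · M · f ↑ 17
    ≈⟨ solve 5 (λ p x s m f → (p :+ x :* s) :* m :* f := x :* (s :* m :* f) :+ p :* m :* f)
        ≋-refl (sq (φ y)) x (sq (Ψ y₂)) M (f ↑ 17) ⟩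
  x · (sq (Ψ y₂) · M · f ↑ 17) ⊕ sq (φ y) · M · f ↑ 17
    ≈⟨ ⊕-cong ≋-refl (·-cong (≋-trans dissection (⊕-cong ≋-refl (·-cong ≋-refl core-dissection))) ≋-refl) ⟩
  x · (sq (Ψ y₂) · M · f ↑ 17) ⊕ (even ⊕ y · y₂ · odd ⊕ y · (y₄ · H ⊕
      (κ (+ 3) · (b · f ↑ 8) ⊕ κ (+ 2) · (w · b ↑ 9)))) · f ↑ 17
    ≈⟨ solve′ (x · (sq (Ψ y₂) · M · f ↑ 17)) even (y · y₂) odd y y₄ H b (f ↑ 8) w (b ↑ 9) (f ↑ 17) ⟩
  x · (sq (Ψ y₂) · M · f ↑ 17) ⊕ even · f ↑ 17 ⊕ y · y₂ · (odd · f ↑ 17) ⊕ y · y₄ · (H · f ↑ 17) ⊕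
    (κ (+ 3) · (y · b · (f ↑ 8 · f ↑ 17)) ⊕ κ (+ 2) · (y · w · (b ↑ 9 · f ↑ 17)))
    ≈⟨ ⊕-cong ≋-refl (⊕-cong
        (·-cong ≋-refl (·-cong ≋-refl (≋-sym (^-homo-* f 8 17))))
        (≋-trans (·-cong ≋-refl (·-cong ≋-refl (Ψ⁹φ¹⁷ w-small)))
          (solve 5 (λ c d yw j k → c :* (yw :* (d :* (j :* k))) := c :* d :* (yw :* j :* k))
            ≋-refl (κ (+ 2)) (κ (+ 2) ↑ 9) (y · w) (J w₂) (J w ↑ 25)))) ⟩
  _ ∎
  where
  open ≋-Reasoning
  M = φ y · sq (φ y₂) · sq (sq a)
  solve′ : ∀ t e yy o y y₄ h b f8 w b9 g →
    t ⊕ (e ⊕ yy · o ⊕ y · (y₄ · h ⊕ (κ (+ 3) · (b · f8) ⊕ κ (+ 2) · (w · b9)))) · g ≋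
    t ⊕ e · g ⊕ yy · (o · g) ⊕ y · y₄ · (h · g) ⊕ (κ (+ 3) · (y · b · (f8 · g)) ⊕ κ (+ 2) · (y · w · (b9 · g)))
  solve′ = solve 12 (λ t e yy o y y₄ h b f8 w b9 g →
    t :+ (e :+ yy :* o :+ y :* (y₄ :* h :+ (con (+ 3) :* (b :* f8) :+ con (+ 2) :* (w :* b9)))) :* g :=
    t :+ e :* g :+ yy :* (o :* g) :+ y :* y₄ :* (h :* g) :+
      (con (+ 3) :* (y :* b :* (f8 :* g)) :+ con (+ 2) :* (y :* w :* (b9 :* g)))) ≋-refl

-- Divisibility of the coefficients of a quotient.

-- In coefficient n of D · B, the terms D i · B (n - i) with i > 0 vanish modulo c
-- by induction.
quotient-divisible : ∀ {c} {P T : ℕ → Set} {D B : Series} → D 0 ≡ 1ℤ → Supp c P D →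
  (∀ i j → P i → T (i + j) → T j) → Supp c (λ n → ¬ T n) (B · D) → ∀ n → T n → c ∣ B n
quotient-divisible {c} {P} {T} {D} {B} D₀ sD difference sBD = ℕ.<-rec _ step
  where
  commuted : ∀ n → T n → c ∣ (D · B) n
  commuted n t with on sBD n
  ... | inj₁ d = ≡-∣ (at (solve 2 (λ b d → b :* d := d :* b) ≋-refl B D) n) d
  ... | inj₂ p = ⊥-elim (p t)
  leading : ∀ n → D 0 ℤ.* B n ≡ B n
  leading n = trans (cong (ℤ._* B n) D₀) (ℤ.*-identityˡ (B n))
  step : ∀ n → (∀ {m} → m < n → T m → c ∣ B m) → T n → c ∣ B n
  step zero _ t = ≡-∣ (trans (·-zero D B) (leading 0)) (commuted 0 t)
  step (suc n) ih t = ≡-∣ (leading (suc n))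
    (∣m+n∣n⇒∣m (≡-∣ (·-suc D B n) (commuted (suc n) t)) rest)
    where
    term : ∀ i j → i + j ≡ n → c ∣ tail D i ℤ.* B j ⊎ ⊥
    term i j refl with on sD (suc i)
    ... | inj₁ d = inj₁ (∣m⇒∣m*n (B j) d)
    ... | inj₂ p = inj₁ (∣n⇒∣m*n (D (suc i)) (ih (s≤s (ℕ.m≤n+m j i)) (difference (suc i) j p t)))
    rest : c ∣ (tail D · B) n
    rest with ·-divides n (tail D) B term
    ... | inj₁ d = d

-- Exponents of the summands of `B · D`.

x-monomial : Monomial 2 x
x-monomial = Monomial-· Supp-q Supp-q

y-monomial : Monomial 4 y
y-monomial = Monomial-· x-monomial x-monomial

y₂-monomial : Monomial 8 y₂
y₂-monomial = Monomial-· y-monomial y-monomial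

y₄-monomial : Monomial 16 y₄
y₄-monomial = Monomial-· y₂-monomial y₂-monomial

w-monomial : Monomial 32 w
w-monomial = Monomial-· y₄-monomial y₄-monomial

w₂-monomial : Monomial 64 w₂
w₂-monomial = Monomial-· w-monomial w-monomial

f-support : ∀ {c} d .{{_ : ℕ.NonZero d}} → 32 % d ≡ 0 → Supp c (Class d 0) f
f-support {c} d e = S-θ w-support w-support
  where
  open Multiples {c} d
  w-support = Supp-− (Supp-weaken (λ _ p → trans p e) (Monomial-Class d w-monomial))

-- By the Chinese remainder theorem these are the residues 68 and 132 modulo 160.
T : ℕ → Set
T n = Class 32 4 n × (Class 5 2 n ⊎ Class 5 3 n)

Avoids : ℕ → Set
Avoids n = ¬ T n

Class-avoids : ∀ {d r} .{{_ : ℕ.NonZero d}} → d ℕ.∣ 32 → 4 % d ≢ r → ∀ n → Class d r n → Avoids n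
Class-avoids {d} d∣32 r≢ n e (e′ , _) =
  r≢ (trans (cong (_% d) (sym e′)) (trans (m∣n⇒o%n%m≡o%m d 32 n d∣32) e))

SquareMod5-avoids : ∀ n → SquareMod5 n → Avoids n
SquareMod5-avoids n (p , _) (_ , inj₁ e) = p e
SquareMod5-avoids n (_ , p) (_ , inj₂ e) = p e

Supp-shift : ∀ {c d r s f g} .{{_ : ℕ.NonZero d}} → Supp c (Class d r) f → Supp c (Class d s) g →
  Supp c (Class d ((r + s) % d)) (f · g)
Supp-shift {d = d} = Supp-· (Class-+ {d})

from-class : ∀ {c d r f} .{{_ : ℕ.NonZero d}} → d ℕ.∣ 32 → 4 % d ≢ r →
  Supp c (Class d r) f → Supp c Avoids f
from-class {r = r} d∣32 r≢ = Supp-weaken (Class-avoids {r = r} d∣32 r≢)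

-- This summand and the next three avoid 4 modulo 32, each by its own power of 2: their exponents
-- are 2 modulo 4, 0 modulo 8, 12 modulo 16 and 20 modulo 32.
first-support : Supp (+ 25) Avoids (x · (sq (Ψ y₂) · (φ y · sq (φ y₂) · sq (sq a)) · f ↑ 17))
first-support = from-class {d = 4} (ℕ.divides 8 refl) (λ ()) (Supp-shift {d = 4}
  (Monomial-Class 4 x-monomial)
  (S-· (S-· (sq-S (S-θ y₂-S S-𝟏)) (S-· (S-· (S-θ y-S y-S) (sq-S (S-θ y₂-S y₂-S)))
    (sq-S (sq-S (S-θ y₄-S y₄-S))))) (S-↑ 17 (f-support 4 refl))))
  where
  open Multiples {+ 25} 4
  y-S = Monomial-Class 4 y-monomial
  y₂-S = Monomial-Class 4 y₂-monomial
  y₄-S = Monomial-Class 4 y₄-monomial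
  sq-S : ∀ {g} → Supp (+ 25) (Class 4 0) g → Supp (+ 25) (Class 4 0) (sq g)
  sq-S s = S-· s s

even-support : Supp (+ 25) Avoids (even · f ↑ 17)
even-support = from-class {d = 8} (ℕ.divides 4 refl) (λ ()) (S-·
  (Supp-⊕ (Supp-⊕ (S-↑ 9 a-S) (S-· (S-· (Supp-κ (+ 4) refl) (S-· (S-↑ 7 a-S) (S-↑ 2 b-S))) y₂-S))
    (S-· (S-· (Supp-κ (+ 3) refl) (S-· (S-↑ 5 a-S) (S-↑ 4 b-S))) (S-· y₂-S y₂-S)))
  (S-↑ 17 (f-support 8 refl)))
  where
  open Multiples {+ 25} 8
  y₂-S = Monomial-Class 8 y₂-monomial
  a-S = S-θ (Monomial-Class 8 y₄-monomial) (Monomial-Class 8 y₄-monomial)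
  b-S = S-θ (Monomial-Class 8 w-monomial) S-𝟏

odd-support : Supp (+ 25) Avoids (y · y₂ · (odd · f ↑ 17))
odd-support = from-class {d = 16} (ℕ.divides 2 refl) (λ ()) (Supp-shift {d = 16}
  (Monomial-Class 16 (Monomial-· y-monomial y₂-monomial))
  (S-· (S-· (Supp-κ (+ 4) refl) (S-· (S-↑ 6 a-S) (S-↑ 3 b-S))) (S-↑ 17 (f-support 16 refl))))
  where
  open Multiples {+ 25} 16
  a-S = S-θ (Monomial-Class 16 y₄-monomial) (Monomial-Class 16 y₄-monomial)
  b-S = S-θ (Monomial-Class 16 w-monomial) S-𝟏

H-support : Supp (+ 25) Avoids (y · y₄ · (H · f ↑ 17))
H-support = from-class {d = 32} (ℕ.divides 1 refl) (λ ()) (Supp-shift {d = 32}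
  (Monomial-Class 32 (Monomial-· y-monomial y₄-monomial))
  (S-· (S-· (Supp-κ (+ 16) refl) (S-· (S-· (S-· A-S C-S) (Supp-⊕ (S-· A-S A-S) (S-· w-S (S-· C-S C-S))))
    (S-θ w-S S-𝟏))) (S-↑ 17 (f-support 32 refl))))
  where
  open Multiples {+ 25} 32
  w-S = Monomial-Class 32 w-monomial
  w₂-S = Monomial-Class 32 w₂-monomial
  A-S = S-· (S-θ w-S w-S) (S-θ w-S w-S)
  C-S = S-· (S-θ w₂-S S-𝟏) (S-θ w₂-S S-𝟏)

yb-support : Supp 0ℤ SquareMod5 (y · b)
yb-support = monomial-θ y-monomial w-monomial (Supp-κ 1ℤ refl)
  (from-yes (ℕ.allUpTo? (λ j → SquareMod5? (4 + tri 32 32 j)) 5))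
  (from-yes (ℕ.allUpTo? (λ j → SquareMod5? (4 + tri 0 32 j)) 5))

ywJ-support : Supp 0ℤ SquareMod5 (y · w · J w₂)
ywJ-support = Supp-≋ (·-cong ≋-refl (≋-sym (pentagonal (·-small w w-small))))
  (monomial-θ (Monomial-· y-monomial w-monomial)
    (Supp-− w₂-monomial) (Supp-− (Monomial-· w₂-monomial w₂-monomial))
    (from-yes (ℕ.allUpTo? (λ j → SquareMod5? (36 + tri 64 192 j)) 5))
    (from-yes (ℕ.allUpTo? (λ j → SquareMod5? (36 + tri 128 192 j)) 5)))

last-support : Supp (+ 25) Avoids
  (κ (+ 3) · (y · b · D) ⊕ κ (+ 2) · (κ (+ 2) ↑ 9) · (y · w · J w₂ · J w ↑ 25))
last-support = Supp-weaken SquareMod5-avoids (Supp-⊕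
  (constant (Supp-κ (+ 3) refl) (Supp-· SquareMod5-+ (Supp-exact yb-support) (25th-power f)))
  (constant (S-· (Supp-κ (+ 2) refl) (S-↑ 9 (Supp-κ (+ 2) refl)))
    (Supp-· SquareMod5-+ (Supp-exact ywJ-support) (25th-power (J w)))))
  where
  open Subring {+ 25} {_≡ 0} refl (λ i j → cong₂ ℕ._+_)
  constant : ∀ {k g} → Supp (+ 25) (_≡ 0) k → Supp (+ 25) SquareMod5 g → Supp (+ 25) SquareMod5 (k · g)
  constant = Supp-· λ { _ _ refl p → p }

B-D-support : Supp (+ 25) Avoids (B · D)
B-D-support = Supp-≋ (≋-sym B-D)
  (Supp-⊕ (Supp-⊕ (Supp-⊕ (Supp-⊕ first-support even-support) odd-support) H-support) last-support)

-- Modulo 25 only exponents divisible by 160 remain: 32 because f is a series in w, 5 because D is a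
-- 25th power.
D-support : Supp (+ 25) (λ n → Class 32 0 n × Class 5 0 n) D
D-support = Supp-× (Multiples.S-↑ 32 25 (f-support 32 refl)) (25th-power f)

D-constant : D 0 ≡ 1ℤ
D-constant = trans (below D-𝟏 0 (s≤s z≤n)) (cong (λ h → h 0) 𝟏≡𝟙)
  where
  f-𝟏 : f ≈[ 1 ] 𝟏
  f-𝟏 = ≈-trans (≋⇒≈ (φ-neg-product w-small))
    (≈-·𝟏 (E-≈𝟏 (·-small w w-small) w-small) (E-≈𝟏 w-small w-small))
  D-𝟏 : D ≈[ 1 ] 𝟏
  D-𝟏 = ≈-trans (↑-≈ 25 f-𝟏) (≋⇒≈ (solve 0 (con 1ℤ :^ 25 := con 1ℤ) ≋-refl))

T-difference : ∀ i j → Class 32 0 i → Class 5 0 i → T (i + j) → T j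
T-difference i j e₃₂ e₅ (t , t′) = trans (sym (drop {32} e₃₂)) t , ⊎-map
  (λ e → trans (sym (drop {5} e₅)) e) (λ e → trans (sym (drop {5} e₅)) e) t′
  where
  drop : ∀ {d} .{{_ : ℕ.NonZero d}} → Class d 0 i → (i + j) % d ≡ j % d
  drop {d} e = trans (%-distribˡ-+ i j d) (trans (cong (λ r → (r + j % d) % d) e) (m%n%n≡m%n j d))

B-divisible : ∀ n → T n → + 25 ∣ B n
B-divisible = quotient-divisible D-constant D-support
  (λ { i j (e , e′) t → T-difference i j e e′ t }) B-D-support

-- From `B` back to `v₀`.

sign-even : ∀ n → sign (n * 2) ≡ 1ℤ
sign-even zero = refl
sign-even (suc n) = trans (ℤ.neg-involutive (sign (n * 2))) (sign-even n)

-- At even exponents `σ v` agrees with `v`. Exponent 0 is left out because the summand -1 of `B`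
-- enters there.
B-even : ∀ n → B (suc n * 2) ≡ + 2 ℤ.* v₀ (suc n * 2)
B-even n = begin
  B m
    ≡⟨ trans (⊕-at _ _ m) (cong₂ ℤ._+_ (⊕-at v (σ v) m) (−-at 𝟏 m)) ⟩
  v m ℤ.+ σ v m ℤ.+ ℤ.- 𝟏 m
    ≡⟨ cong₂ (λ s o → v m ℤ.+ s ℤ.+ ℤ.- o)
        (trans (σ-at v m) (cong (ℤ._* v m) (sign-even (suc n)))) (cong (λ h → h m) 𝟏≡𝟙) ⟩
  v m ℤ.+ 1ℤ ℤ.* v m ℤ.+ 0ℤ
    ≡⟨ double (v m) ⟩
  + 2 ℤ.* v m
    ≡⟨ cong (λ h → + 2 ℤ.* h m) v≡v₀ ⟩
  + 2 ℤ.* v₀ m ∎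
  where
  open ≡-Reasoning
  m = suc n * 2
  double : ∀ c → c ℤ.+ 1ℤ ℤ.* c ℤ.+ 0ℤ ≡ + 2 ℤ.* c
  double = solve-∀

-- -12 is an inverse of 2 modulo 25: c = 25c - 12 · 2c.
halve : ∀ c → + 25 ∣ + 2 ℤ.* c → + 25 ∣ c
halve c (divides k e) = divides (c ℤ.- + 12 ℤ.* k) (trans (expand c)
  (trans (cong (λ d → c ℤ.* + 25 ℤ.- + 12 ℤ.* d) e) (collect c k)))
  where
  expand : ∀ c → c ≡ c ℤ.* + 25 ℤ.- + 12 ℤ.* (+ 2 ℤ.* c)
  expand = solve-∀
  collect : ∀ c k → c ℤ.* + 25 ℤ.- + 12 ℤ.* (k ℤ.* + 25) ≡ (c ℤ.- + 12 ℤ.* k) ℤ.* + 25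
  collect = solve-∀

v₀-divisible : ∀ n → T (suc n * 2) → + 25 ∣ v₀ (suc n * 2)
v₀-divisible n t = halve _ (≡-∣ (B-even n) (B-divisible _ t))

theorem5p3 : ∀ (n r : ℕ) → r ∈ 68 ∷ 132 ∷ [] → + 25 ∣ v₀ (160 * n + r)
theorem5p3 n _ (here refl) = subst (λ m → + 25 ∣ v₀ m) (index n)
  (v₀-divisible (80 * n + 33) (class₃₂ , inj₂ class₅))
  where
  index : ∀ n → suc (80 * n + 33) * 2 ≡ 160 * n + 68
  index = ℕ-solve-∀
  by-32 : ∀ n → suc (80 * n + 33) * 2 ≡ 68 + (5 * n) * 32
  by-32 = ℕ-solve-∀
  by-5 : ∀ n → suc (80 * n + 33) * 2 ≡ 68 + (32 * n) * 5
  by-5 = ℕ-solve-∀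
  class₃₂ : Class 32 4 (suc (80 * n + 33) * 2)
  class₃₂ = trans (cong (_% 32) (by-32 n)) ([m+kn]%n≡m%n 68 (5 * n) 32)
  class₅ : Class 5 3 (suc (80 * n + 33) * 2)
  class₅ = trans (cong (_% 5) (by-5 n)) ([m+kn]%n≡m%n 68 (32 * n) 5)
theorem5p3 n _ (there (here refl)) = subst (λ m → + 25 ∣ v₀ m) (index n)
  (v₀-divisible (80 * n + 65) (class₃₂ , inj₁ class₅))
  where
  index : ∀ n → suc (80 * n + 65) * 2 ≡ 160 * n + 132
  index = ℕ-solve-∀
  by-32 : ∀ n → suc (80 * n + 65) * 2 ≡ 132 + (5 * n) * 32
  by-32 = ℕ-solve-∀
  by-5 : ∀ n → suc (80 * n + 65) * 2 ≡ 132 + (32 * n) * 5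
  by-5 = ℕ-solve-∀
  class₃₂ : Class 32 4 (suc (80 * n + 65) * 2)
  class₃₂ = trans (cong (_% 32) (by-32 n)) ([m+kn]%n≡m%n 132 (5 * n) 32)
  class₅ : Class 5 2 (suc (80 * n + 65) * 2)
  class₅ = trans (cong (_% 5) (by-5 n)) ([m+kn]%n≡m%n 132 (32 * n) 5)
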